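{- Let $c,d\in\mathbb{N}$, $I=\mathbb{N}^d\times[c]$, $I_n=[n]^d\times[c]$. Let $\mathfrak{L}=(L_n)_{n\ge1}$ be a $\mathrm{Sym}$-invariant chain of lattices with limit $L=\bigcup_{n\ge1}L_n$. Then the following are equivalent: (i) $\mathfrak{L}$ stabilizes, i.e. there is $p\in\mathbb{N}$ with $L_n=\mathbb{Z}\,\mathrm{Sym}(n)(L_m)$ for all $n\ge m\ge p$; (ii) there exist $p\in\mathbb{N}$ and an equivariant generating set $\mathcal{B}_p$ of $L_p$ such that $\mathcal{B}_p$ is also an equivariant generating set of $L_n$ for all $n\ge p$; (iii) there exist $q,q'\in\mathbb{N}$ such that for all $n\ge q$: (a) $L_n=L\cap\mathbb{Z}^{(I_n)}$, and (b) $L_n$ is generated by elements of support size at most $q'$; (iv) $L$ has a finite equivariant generating set.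
   Context: $\mathbb{N}=\{1,2,\dots\}$, $[n]=\{1,\dots,n\}$. $\mathbb{Z}^{(I)}$ is the free abelian group with basis $I$ (finitely supported integer vectors), with standard basis $\mathbf{e}_{\mathbf{i},j}$; $\mathbb{Z}^{(I_n)}$ is regarded as a subgroup of $\mathbb{Z}^{(I)}$ via extension by zero. A lattice is a subgroup. The support size of $\mathbf{u}$ is the number of indices with nonzero entry. $\mathrm{Sym}(n)$ is the symmetric group on $[n]$, embedded in $\mathrm{Sym}(n+1)$ as the stabilizer of $n+1$; $\mathrm{Sym}=\bigcup_n\mathrm{Sym}(n)$. $\mathrm{Sym}$ acts on $\mathbb{Z}^{(I)}$ by the linear extension of $\sigma(\mathbf{e}_{(i_1,\dots,i_d),j})=\mathbf{e}_{(\sigma(i_1),\dots,\sigma(i_d)),j}$, and this restricts to an action of $\mathrm{Sym}(n)$ on $\mathbb{Z}^{(I_n)}$. For a set $A$ and group $G$, $G(A)=\{\sigma(\mathbf{u})\mid\sigma\in G,\mathbf{u}\in A\}$, and $\mathbb{Z}A$ is the subgroup generated by $A$. A $\mathrm{Sym}$-invariant chain of lattices is a sequence $(L_n)_{n\ge1}$ with $L_n\subseteq\mathbb{Z}^{(I_n)}$ a lattice, $L_m\subseteq L_n$ for $m\le n$, and each $L_n$ being $\mathrm{Sym}(n)$-invariant. For a $\mathrm{Sym}(n)$-invariant lattice $L_n\subseteq\mathbb{Z}^{(I_n)}$ (resp. $\mathrm{Sym}$-invariant lattice $L\subseteq\mathbb{Z}^{(I)}$), $\mathcal{B}\subseteq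 L_n$ is an equivariant generating set if $\mathrm{Sym}(n)(\mathcal{B})$ (resp. $\mathrm{Sym}(\mathcal{B})$) generates it as an abelian group. -}

module Defs where

open import Level using (0ℓ)
open import Data.Nat.Base using (ℕ; _≤_; _<_)
import Data.Nat.Properties as ℕ
open import Data.Integer.Base as ℤ using (ℤ; 0ℤ; 1ℤ)
import Data.Integer.Properties as ℤ
open import Data.Fin.Base using (Fin)
import Data.Fin.Properties as Fin
open import Data.Vec.Base as Vec using (Vec)
import Data.Vec.Properties as Vec
open import Data.Vec.Relation.Unary.All as VecAll using ()
open import Data.List.Base as List using (List; []; _∷_; _++_; length; filter; deduplicate)
open import Data.List.Membership.Propositional using (_∈_)
open import Data.List.Membership.Propositional.Properties using (∈-++⁺ˡ; ∈-++⁺ʳ; ∈-map⁺)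
open import Data.List.Relation.Unary.Any using (Any; here)
open import Data.Product.Base using (_×_; _,_; ∃-syntax; Σ-syntax)
import Data.Product.Properties as Product
open import Data.Empty using (⊥-elim)
open import Function.Bundles using (_↔_; Inverse)
open import Function.Construct.Symmetry using (↔-sym)
open import Relation.Binary.Definitions using (DecidableEquality)
open import Relation.Binary.PropositionalEquality using (_≡_; _≢_; refl; sym; trans; cong; cong₂; subst)
open import Relation.Nullary.Decidable using (Dec; yes; no; ¬?)
open import Relation.Unary using (Pred; _⊆_; _≐_; _∩_)

private
  variable
    c d : ℕ

-- Row indices are counted from 0, so ℕ here plays the role of {1,2,…} and
-- {i | i < n} the role of [n].
Index : ℕ → ℕ → Set
Index c d = Vec ℕ d × Fin c

_≟ᴵ_ : DecidableEquality (Index c d)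
_≟ᴵ_ = Product.≡-dec (Vec.≡-dec ℕ._≟_) Fin._≟_

-- I_n = [n]^d × [c]
I⟨_⟩ : ℕ → Pred (Index c d) 0ℓ
I⟨ n ⟩ (is , _) = VecAll.All (_< n) is

-- ℤ^(I).  The list may contain repetitions and indices whose entry is zero;
-- vectors are compared by _≈_, which ignores it.
record ℤ^I (c d : ℕ) : Set where
  constructor mkℤ^I
  field
    coeff   : Index c d → ℤ
    bound   : List (Index c d)
    bounded : ∀ i → coeff i ≢ 0ℤ → i ∈ bound

open ℤ^I public

infix 4 _≈_
_≈_ : ℤ^I c d → ℤ^I c d → Set
u ≈ v = ∀ i → coeff u i ≡ coeff v i

supportSize : ℤ^I c d → ℕ
supportSize u = length (filter (λ i → ¬? (coeff u i ℤ.≟ 0ℤ)) (deduplicate _≟ᴵ_ (bound u)))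

-- ℤ^(I_n), inside ℤ^(I) via extension by zero
ℤ^I⟨_⟩ : ℕ → Pred (ℤ^I c d) 0ℓ
ℤ^I⟨ n ⟩ u = ∀ i → coeff u i ≢ 0ℤ → I⟨ n ⟩ i

𝟎 : ℤ^I c d
𝟎 = mkℤ^I (λ _ → 0ℤ) [] (λ _ 0≢0 → ⊥-elim (0≢0 refl))

infixl 6 _⊕_
_⊕_ : ℤ^I c d → ℤ^I c d → ℤ^I c d
coeff   (u ⊕ v) i = coeff u i ℤ.+ coeff v i
bound   (u ⊕ v)   = bound u ++ bound v
bounded (u ⊕ v) i ≢0 with coeff u i ℤ.≟ 0ℤ
... | no  u≢0 = ∈-++⁺ˡ (bounded u i u≢0)
... | yes u≡0 = ∈-++⁺ʳ (bound u) (bounded v i λ v≡0 → ≢0 (cong₂ ℤ._+_ u≡0 v≡0))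

⊖_ : ℤ^I c d → ℤ^I c d
coeff   (⊖ u) i    = ℤ.- coeff u i
bound   (⊖ u)      = bound u
bounded (⊖ u) i ≢0 = bounded u i λ u≡0 → ≢0 (cong ℤ.-_ u≡0)

record IsLattice (L : Pred (ℤ^I c d) 0ℓ) : Set where
  field
    resp-≈   : ∀ {u v} → u ≈ v → L u → L v
    𝟎-closed : L 𝟎
    ⊕-closed : ∀ {u v} → L u → L v → L (u ⊕ v)
    ⊖-closed : ∀ {u} → L u → L (⊖ u)

-- ℤA
data ℤ⟨_⟩ (A : Pred (ℤ^I c d) 0ℓ) : Pred (ℤ^I c d) 0ℓ where
  gen  : ∀ {u} → A u → ℤ⟨ A ⟩ u
  zero : ℤ⟨ A ⟩ 𝟎
  add  : ∀ {u v} → ℤ⟨ A ⟩ u → ℤ⟨ A ⟩ v → ℤ⟨ A ⟩ (u ⊕ v)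
  neg  : ∀ {u} → ℤ⟨ A ⟩ u → ℤ⟨ A ⟩ (⊖ u)
  resp : ∀ {u v} → u ≈ v → ℤ⟨ A ⟩ u → ℤ⟨ A ⟩ v

-- Because of the embeddings Sym(n) ⊆ Sym(n+1), an element of Sym(n) is
-- given as a permutation of ℕ fixing everything outside [n].
Sym⟨_⟩ : ℕ → Pred (ℕ ↔ ℕ) 0ℓ
Sym⟨ n ⟩ σ = ∀ i → n ≤ i → Inverse.to σ i ≡ i

Sym : Pred (ℕ ↔ ℕ) 0ℓ
Sym σ = ∃[ n ] Sym⟨ n ⟩ σ

infixr 7 _•ᴵ_ _•_

_•ᴵ_ : ℕ ↔ ℕ → Index c d → Index c d
σ •ᴵ (is , j) = Vec.map (Inverse.to σ) is , j

•ᴵ-cancelˡ : ∀ σ (i : Index c d) → ↔-sym σ •ᴵ σ •ᴵ i ≡ i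
•ᴵ-cancelˡ σ (is , j) = cong (_, j)
  (trans (sym (Vec.map-∘ _ _ is))
  (trans (Vec.map-cong (Inverse.strictlyInverseʳ σ) is) (Vec.map-id is)))

•ᴵ-cancelʳ : ∀ σ (i : Index c d) → σ •ᴵ ↔-sym σ •ᴵ i ≡ i
•ᴵ-cancelʳ σ (is , j) = cong (_, j)
  (trans (sym (Vec.map-∘ _ _ is))
  (trans (Vec.map-cong (Inverse.strictlyInverseˡ σ) is) (Vec.map-id is)))

-- The linear extension of e_i ↦ e_{σ(i)}; see •-𝐞.
_•_ : ℕ ↔ ℕ → ℤ^I c d → ℤ^I c d
coeff   (σ • u) i    = coeff u (↔-sym σ •ᴵ i)
bound   (σ • u)      = List.map (σ •ᴵ_) (bound u)
bounded (σ • u) i ≢0 = subst (_∈ List.map (σ •ᴵ_) (bound u)) (•ᴵ-cancelʳ σ i)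
                         (∈-map⁺ (σ •ᴵ_) (bounded u (↔-sym σ •ᴵ i) ≢0))

δ : {P : Set} → Dec P → ℤ
δ (yes _) = 1ℤ
δ (no  _) = 0ℤ

𝐞 : Index c d → ℤ^I c d
coeff   (𝐞 k) i = δ (i ≟ᴵ k)
bound   (𝐞 k)   = k ∷ []
bounded (𝐞 k) i ≢0 with i ≟ᴵ k
... | yes i≡k = here i≡k
... | no  _   = ⊥-elim (≢0 refl)

•-𝐞 : ∀ σ (k : Index c d) → σ • 𝐞 k ≈ 𝐞 (σ •ᴵ k)
•-𝐞 σ k i with (↔-sym σ •ᴵ i) ≟ᴵ k | i ≟ᴵ (σ •ᴵ k)
... | yes _ | yes _ = refl
... | no  _ | no  _ = refl
... | yes p | no ¬q = ⊥-elim (¬q (trans (sym (•ᴵ-cancelʳ σ i)) (cong (σ •ᴵ_) p)))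
... | no ¬p | yes q = ⊥-elim (¬p (trans (cong (↔-sym σ •ᴵ_) q) (•ᴵ-cancelˡ σ k)))

-- G(A)
_[_] : Pred (ℕ ↔ ℕ) 0ℓ → Pred (ℤ^I c d) 0ℓ → Pred (ℤ^I c d) 0ℓ
(G [ A ]) v = ∃[ σ ] ∃[ u ] G σ × A u × v ≈ σ • u

IsEquivariantGeneratingSet : Pred (ℕ ↔ ℕ) 0ℓ → Pred (ℤ^I c d) 0ℓ → Pred (ℤ^I c d) 0ℓ → Set
IsEquivariantGeneratingSet G L B = B ⊆ L × ℤ⟨ G [ B ] ⟩ ≐ L

-- Only the members with index n ≥ 1 belong to the chain; L 0 is arbitrary
-- and is never used.
record SymInvariantChain (c d : ℕ) : Set₁ where
  field
    L         : ℕ → Pred (ℤ^I c d) 0ℓ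
    isLattice : ∀ {n} → 1 ≤ n → IsLattice (L n)
    inside    : ∀ {n} → 1 ≤ n → L n ⊆ ℤ^I⟨ n ⟩
    monotone  : ∀ {m n} → 1 ≤ m → m ≤ n → L m ⊆ L n
    invariant : ∀ {n} → 1 ≤ n → ∀ {σ u} → Sym⟨ n ⟩ σ → L n u → L n (σ • u)

module _ (𝔏 : SymInvariantChain c d) where
  open SymInvariantChain 𝔏

  limit : Pred (ℤ^I c d) 0ℓ
  limit u = ∃[ n ] 1 ≤ n × L n u

  Stabilizes : Set
  Stabilizes = ∃[ p ] 1 ≤ p × (∀ m n → p ≤ m → m ≤ n → L n ≐ ℤ⟨ Sym⟨ n ⟩ [ L m ] ⟩)

  HasStableEquivariantGeneratingSet : Set₁
  HasStableEquivariantGeneratingSet =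
    ∃[ p ] 1 ≤ p × (Σ[ B ∈ Pred (ℤ^I c d) 0ℓ ]
      IsEquivariantGeneratingSet Sym⟨ p ⟩ (L p) B ×
      (∀ n → p ≤ n → IsEquivariantGeneratingSet Sym⟨ n ⟩ (L n) B))

  GeneratedBySupportSize≤ : ℕ → ℕ → Set₁
  GeneratedBySupportSize≤ q′ n =
    Σ[ A ∈ Pred (ℤ^I c d) 0ℓ ]
      A ⊆ L n × (∀ {u} → A u → supportSize u ≤ q′) × ℤ⟨ A ⟩ ≐ L n

  EventuallySaturatedWithBoundedSupport : Set₁
  EventuallySaturatedWithBoundedSupport =
    ∃[ q ] ∃[ q′ ] 1 ≤ q × 1 ≤ q′ ×
      (∀ n → q ≤ n → L n ≐ (limit ∩ ℤ^I⟨ n ⟩) × GeneratedBySupportSize≤ q′ n)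

  LimitHasFiniteEquivariantGeneratingSet : Set
  LimitHasFiniteEquivariantGeneratingSet =
    Σ[ bs ∈ List (ℤ^I c d) ]
      IsEquivariantGeneratingSet Sym limit (λ u → Any (u ≈_) bs)

{-# OPTIONS --safe #-}

-- The substance is (iv) ⇒ (ii): if B ⊆ ℤ^(I_p) and n is large, an
-- element of ℤ Sym(B) lying in ℤ^(I_n) already lies in ℤ Sym(n)(B).  The rows
-- outside [n] are eliminated one at a time from a sum of translates of B.  A
-- product of d + 1 differences 1 - (a b) over disjoint transpositions kills
-- ℤ^(I), since some pair {a, b} avoids the d rows of a given index.  Hence
-- modulo translates missing the row t to be eliminated, every translate is a
-- combination of translates each missing one of d auxiliary rows s.  A
-- combination of translates missing s whose components along t cancel is
-- fixed by (t s), and so can be rewritten without t.  Arranging this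
-- cancellation for every s separately is an elimination problem for the
-- components along t, where one row of each index is already used up: the
-- induction is on d minus the number of such rows.
--
-- For (iii) ⇒ (iv), a vector of support size at most q′ involves at most q′d
-- rows, so it is a translate of an element of L_m with m = max(q, q′d), and L_m
-- is finitely generated as a subgroup of ℤ^(I_m).

module Submission where

open import Defs
open import Level using (0ℓ)
open import Axiom.ExcludedMiddle using (ExcludedMiddle)
open import Data.Empty using (⊥-elim)
open import Data.Integer.Base as ℤ using (ℤ; 0ℤ)
import Data.Integer.Properties as ℤ
open import Data.Integer.DivMod as ℤ using (a≡a%n+[a/n]*n; n%d<d)
open import Data.Integer.Tactic.RingSolver using (solve-∀)
open import Data.List.Base using (List; []; _∷_; _++_; length; map; filter; take; drop; upTo; zip; allFin; cartesianProduct; cartesianProductWith; concatMap; deduplicate)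
import Data.List.Properties as List
open import Data.List.Extrema.Nat using (max; xs≤max)
open import Data.List.Membership.Propositional using (_∈_; _∉_)
open import Data.List.Membership.Propositional.Properties using (∈-++⁺ˡ; ∈-++⁺ʳ; ∈-++⁻; ∈-∃++; ∈-filter⁺; ∈-filter⁻; ∈-map⁺; ∈-map⁻; ∈-upTo⁺; ∈-upTo⁻; ∈-allFin; ∈-cartesianProduct⁺; ∈-cartesianProductWith⁺; ∈-concatMap⁺; ∈-deduplicate⁺)
import Data.List.Membership.DecPropositional as DecMembership
open import Data.List.Relation.Binary.Disjoint.Propositional using (Disjoint)
open import Data.List.Relation.Unary.All as All using (All; []; _∷_)
import Data.List.Relation.Unary.All.Properties as All
open import Data.List.Relation.Unary.AllPairs using (AllPairs; []; _∷_)
open import Data.List.Relation.Unary.Any as Any using (Any; here; there)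
open import Data.List.Relation.Unary.Unique.Propositional using (Unique)
open import Data.List.Relation.Unary.Unique.Propositional.Properties using (upTo⁺; filter⁺; take⁺; drop⁺)
import Data.List.Relation.Unary.Unique.DecPropositional.Properties as DecUnique
open import Data.Nat.Base using (ℕ; zero; suc; _+_; _*_; _∸_; _⊔_; _⊓_; _≤_; _<_; z≤n; s≤s)
import Data.Nat.Properties as ℕ
open import Data.Product.Base using (_×_; _,_; proj₁; proj₂; ∃-syntax)
open import Data.Sum.Base using (_⊎_; inj₁; inj₂)
import Data.Vec.Base as Vec
import Data.Vec.Properties as Vec
import Data.Vec.Relation.Unary.All as VecAll
import Data.Vec.Relation.Unary.All.Properties as VecAll
open import Function.Base using (id; _∘_; case_of_)
open import Function.Bundles using (_⇔_; _↔_; Inverse; mk↔ₛ′; mk⇔)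
open import Function.Construct.Composition using (_↔-∘_)
open import Function.Construct.Identity using (↔-id)
open import Function.Construct.Symmetry using (↔-sym)
open import Relation.Binary.PropositionalEquality using (_≡_; _≢_; refl; sym; trans; cong; cong₂; subst; module ≡-Reasoning)
open import Relation.Nullary.Decidable using (yes; no; ¬?)
open import Relation.Nullary.Negation using (¬_; contradiction)
open import Relation.Unary using (Pred; _⊆_; _∩_)

open DecMembership ℕ._≟_ using (_∈?_; _∉?_)

private
  variable
    c d : ℕ

-- Lists without repetitions

unique-length-≤ : {A : Set} {xs ys : List A} → Unique xs → (∀ {x} → x ∈ xs → x ∈ ys) → length xs ≤ length ys
unique-length-≤ []               _     = z≤n
unique-length-≤ {xs = x ∷ xs} (x∉xs ∷ xs!) xs⊆ys with ∈-∃++ (xs⊆ys (here refl))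
... | as , bs , refl = begin
  suc (length xs)           ≤⟨ s≤s (unique-length-≤ xs! xs⊆) ⟩
  suc (length (as ++ bs))   ≡⟨ cong suc (List.length-++ as) ⟩
  suc (length as + length bs) ≡⟨ ℕ.+-suc (length as) (length bs) ⟨
  length as + suc (length bs) ≡⟨ List.length-++ as ⟨
  length (as ++ x ∷ bs)     ∎
  where
  open ℕ.≤-Reasoning
  xs⊆ : ∀ {y} → y ∈ xs → y ∈ as ++ bs
  xs⊆ y∈xs with ∈-++⁻ as (xs⊆ys (there y∈xs))
  ... | inj₁ y∈as          = ∈-++⁺ˡ y∈as
  ... | inj₂ (here y≡x)    = contradiction (sym y≡x) (All.lookup x∉xs y∈xs)
  ... | inj₂ (there y∈bs)  = ∈-++⁺ʳ as y∈bs

∈-take⁻ : {A : Set} {x : A} → ∀ n xs → x ∈ take n xs → x ∈ xs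
∈-take⁻ {x = x} n xs x∈ = subst (x ∈_) (List.take++drop≡id n xs) (∈-++⁺ˡ x∈)

∈-drop⁻ : {A : Set} {x : A} → ∀ n xs → x ∈ drop n xs → x ∈ xs
∈-drop⁻ {x = x} n xs x∈ = subst (x ∈_) (List.take++drop≡id n xs) (∈-++⁺ʳ (take n xs) x∈)

take-drop-disjoint : {A : Set} {xs : List A} → ∀ n → Unique xs → Disjoint (take n xs) (drop n xs)
take-drop-disjoint {xs = x ∷ xs} (suc n) (x∉ ∷ _)  (here refl , x∈drop) = All.lookup x∉ (∈-drop⁻ n xs x∈drop) refl
take-drop-disjoint {xs = x ∷ xs} (suc n) (_ ∷ xs!) (there ∈take , ∈drop) = take-drop-disjoint n xs! (∈take , ∈drop)

-- At most `length S` of the distinct entries of `xs` lie in `S`, so at least `n` survive the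
-- filter. This supplies the partners `b` of the differences 1 - (a b).
fresh : ∀ n S {xs} → Unique xs → length S + n ≤ length xs →
        ∃[ bs ] length bs ≡ n × Unique bs × Disjoint bs S × (∀ {b} → b ∈ bs → b ∈ xs)
fresh n S {xs} xs! S+n≤ =
  take n ys , trans (List.length-take n ys) (ℕ.m≤n⇒m⊓n≡m n≤) , take⁺ n (filter⁺ (_∉? S) xs!) ,
  (λ (b∈ , b∈S) → proj₂ (∈-filter⁻ (_∉? S) {xs = xs} (∈-take⁻ n ys b∈)) b∈S) ,
  λ b∈ → proj₁ (∈-filter⁻ (_∉? S) (∈-take⁻ n ys b∈))
  where
  ys = filter (_∉? S) xs
  covered : ∀ {x} → x ∈ xs → x ∈ S ++ ys
  covered {x} x∈xs with x ∈? S
  ... | yes x∈S = ∈-++⁺ˡ x∈S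
  ... | no  x∉S = ∈-++⁺ʳ S (∈-filter⁺ (_∉? S) x∈xs x∉S)
  n≤ : n ≤ length ys
  n≤ = ℕ.+-cancelˡ-≤ (length S) _ _ (ℕ.≤-trans S+n≤
         (ℕ.≤-trans (unique-length-≤ xs! covered) (ℕ.≤-reflexive (List.length-++ S))))

-- Transpositions of ℕ

swap : ℕ → ℕ → ℕ → ℕ
swap a b i with i ℕ.≟ a | i ℕ.≟ b
... | yes _ | _     = b
... | no  _ | yes _ = a
... | no  _ | no  _ = i

swap-left : ∀ a b → swap a b a ≡ b
swap-left a b with a ℕ.≟ a | a ℕ.≟ b
... | yes _  | _ = refl
... | no a≢a | _ = contradiction refl a≢a

swap-right : ∀ a b → swap a b b ≡ a
swap-right a b with b ℕ.≟ a | b ℕ.≟ b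
... | yes b≡a | _      = b≡a
... | no _    | yes _  = refl
... | no _    | no b≢b = contradiction refl b≢b

swap-other : ∀ {a b i} → i ≢ a → i ≢ b → swap a b i ≡ i
swap-other {a} {b} {i} i≢a i≢b with i ℕ.≟ a | i ℕ.≟ b
... | yes i≡a | _       = contradiction i≡a i≢a
... | no _    | yes i≡b = contradiction i≡b i≢b
... | no _    | no _    = refl

swap-cases : ∀ a b i → (i ≡ a × swap a b i ≡ b) ⊎ (i ≡ b × swap a b i ≡ a) ⊎ (i ≢ a × i ≢ b × swap a b i ≡ i)
swap-cases a b i with i ℕ.≟ a | i ℕ.≟ b
... | yes i≡a | _       = inj₁ (i≡a , refl)
... | no _    | yes i≡b = inj₂ (inj₁ (i≡b , refl))
... | no i≢a  | no i≢b  = inj₂ (inj₂ (i≢a , i≢b , refl))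

swap-involutive : ∀ a b i → swap a b (swap a b i) ≡ i
swap-involutive a b i with swap-cases a b i
... | inj₁ (i≡a , eq)              = trans (cong (swap a b) eq) (trans (swap-right a b) (sym i≡a))
... | inj₂ (inj₁ (i≡b , eq))       = trans (cong (swap a b) eq) (trans (swap-left a b) (sym i≡b))
... | inj₂ (inj₂ (_ , _ , eq))     = trans (cong (swap a b) eq) eq

transposition : ℕ → ℕ → ℕ ↔ ℕ
transposition a b = mk↔ₛ′ (swap a b) (swap a b) (swap-involutive a b) (swap-involutive a b)

swap-Sym : ∀ {a b n} → a < n → b < n → Sym⟨ n ⟩ (transposition a b)
swap-Sym a<n b<n i n≤i = swap-other (λ { refl → ℕ.<⇒≱ a<n n≤i }) (λ { refl → ℕ.<⇒≱ b<n n≤i })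

to-injective : (σ : ℕ ↔ ℕ) → ∀ {i j} → Inverse.to σ i ≡ Inverse.to σ j → i ≡ j
to-injective σ {i} {j} eq = trans (sym (Inverse.strictlyInverseʳ σ i))
  (trans (cong (Inverse.from σ) eq) (Inverse.strictlyInverseʳ σ j))

-- The values are corrected one at a time by a transposition.
restrict-Sym : (σ : ℕ ↔ ℕ) → ∀ {n} p → p ≤ n → (∀ {i} → i < p → Inverse.to σ i < n) →
               ∃[ τ ] Sym⟨ n ⟩ τ × (∀ {i} → i < p → Inverse.to τ i ≡ Inverse.to σ i)
restrict-Sym σ zero    _   _   = ↔-id ℕ , (λ _ _ → refl) , λ ()
restrict-Sym σ {n} (suc p) p<n σ<n
  with restrict-Sym σ p (ℕ.<⇒≤ p<n) (λ i<p → σ<n (ℕ.m<n⇒m<1+n i<p))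
... | τ , τ∈Sym , τ≡σ = θ ↔-∘ τ , fixes , agrees
  where
  to = Inverse.to
  θ = transposition (to τ p) (to σ p)
  τp<n : to τ p < n
  τp<n with to τ p ℕ.<? n
  ... | yes lt = lt
  -- A value at or above `n` is fixed by `τ`, so injectivity would make it equal to `p`, which is
  -- below `n`.
  ... | no ≮n = contradiction (subst (_< n) (sym (to-injective τ (τ∈Sym (to τ p) (ℕ.≮⇒≥ ≮n)))) p<n) ≮n
  fixes : Sym⟨ n ⟩ (θ ↔-∘ τ)
  fixes i n≤i = trans (cong (to θ) (τ∈Sym i n≤i)) (swap-Sym τp<n (σ<n ℕ.≤-refl) i n≤i)
  agrees : ∀ {i} → i < suc p → to (θ ↔-∘ τ) i ≡ to σ i
  agrees {i} i<1+p with ℕ.m<1+n⇒m<n∨m≡n i<1+p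
  ... | inj₂ refl = swap-left (to τ p) (to σ p)
  -- `to τ i` differs from `to τ p`, and from `to σ p` because it equals `to σ i`; so `θ` leaves it
  -- alone.
  ... | inj₁ i<p  = trans (swap-other (ℕ.<⇒≢ i<p ∘ to-injective τ)
          (λ eq → ℕ.<⇒≢ i<p (to-injective σ (trans (sym (τ≡σ i<p)) eq)))) (τ≡σ i<p)

-- Row indices

rows : Index c d → List ℕ
rows (is , _) = Vec.toList is

rows-• : (σ : ℕ ↔ ℕ) (i : Index c d) → rows (σ •ᴵ i) ≡ map (Inverse.to σ) (rows i)
rows-• σ (is , _) = Vec.toList-map (Inverse.to σ) is

∈-rows-• : (σ : ℕ ↔ ℕ) (i : Index c d) → ∀ {x} → x ∈ rows i → Inverse.to σ x ∈ rows (σ •ᴵ i)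
∈-rows-• σ i x∈ = subst (_ ∈_) (sym (rows-• σ i)) (∈-map⁺ (Inverse.to σ) x∈)

∈-rows-•⁻ : (σ : ℕ ↔ ℕ) (i : Index c d) → ∀ {x} → x ∈ rows (σ •ᴵ i) → ∃[ y ] y ∈ rows i × x ≡ Inverse.to σ y
∈-rows-•⁻ σ i x∈ = ∈-map⁻ (Inverse.to σ) (subst (_ ∈_) (rows-• σ i) x∈)

rows-<⇒I : ∀ {n} (i : Index c d) → (∀ {x} → x ∈ rows i → x < n) → I⟨ n ⟩ i
rows-<⇒I i rows< = VecAll.toList⁻ (All.tabulate rows<)

I⇒rows-< : ∀ {n} (i : Index c d) → I⟨ n ⟩ i → ∀ {x} → x ∈ rows i → x < n
I⇒rows-< i i∈I = All.lookup (VecAll.toList⁺ i∈I)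

-- The action on indices and on vectors

•ᴵ-cong : {σ τ : ℕ ↔ ℕ} (i : Index c d) →
          (∀ {x} → x ∈ rows i → Inverse.to σ x ≡ Inverse.to τ x) → σ •ᴵ i ≡ τ •ᴵ i
•ᴵ-cong {σ = σ} {τ} (is , j) eq = cong (_, j) (go is eq)
  where
  go : ∀ {n} (is : Vec.Vec ℕ n) → (∀ {x} → x ∈ Vec.toList is → Inverse.to σ x ≡ Inverse.to τ x) →
       Vec.map (Inverse.to σ) is ≡ Vec.map (Inverse.to τ) is
  go Vec.[]       _  = refl
  go (x Vec.∷ is) eq = cong₂ Vec._∷_ (eq (here refl)) (go is (eq ∘ there))

•ᴵ-id : (i : Index c d) → ↔-id ℕ •ᴵ i ≡ i
•ᴵ-id (is , j) = cong (_, j) (Vec.map-id is)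

•ᴵ-∘ : (σ τ : ℕ ↔ ℕ) (i : Index c d) → (σ ↔-∘ τ) •ᴵ i ≡ σ •ᴵ τ •ᴵ i
•ᴵ-∘ σ τ (is , j) = cong (_, j) (Vec.map-∘ (Inverse.to σ) (Inverse.to τ) is)

transposition-fixes : ∀ {a b} (i : Index c d) → a ∉ rows i → b ∉ rows i → transposition a b •ᴵ i ≡ i
transposition-fixes {a = a} {b} i a∉ b∉ =
  trans (•ᴵ-cong {σ = transposition a b} {τ = ↔-id ℕ} i (λ x∈ → swap-other (λ { refl → a∉ x∈ }) (λ { refl → b∉ x∈ })))
        (•ᴵ-id i)

•-∘ : (σ τ : ℕ ↔ ℕ) (u : ℤ^I c d) → (σ ↔-∘ τ) • u ≈ σ • τ • u
•-∘ σ τ u i = cong (coeff u) (•ᴵ-∘ (↔-sym τ) (↔-sym σ) i)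

•-cong : (σ : ℕ ↔ ℕ) {u v : ℤ^I c d} → u ≈ v → σ • u ≈ σ • v
•-cong σ u≈v i = u≈v (↔-sym σ •ᴵ i)

inverses-agree : ∀ {p} (σ τ : ℕ ↔ ℕ) → (∀ {x} → x < p → Inverse.to σ x ≡ Inverse.to τ x) →
                 (i : Index c d) → I⟨ p ⟩ (↔-sym σ •ᴵ i) → ↔-sym σ •ᴵ i ≡ ↔-sym τ •ᴵ i
inverses-agree σ τ σ≡τ i j∈ = begin
  j                      ≡⟨ •ᴵ-cancelˡ τ j ⟨
  ↔-sym τ •ᴵ τ •ᴵ j      ≡⟨ cong (↔-sym τ •ᴵ_) (•ᴵ-cong {σ = σ} {τ} j (σ≡τ ∘ I⇒rows-< j j∈)) ⟨
  ↔-sym τ •ᴵ σ •ᴵ j      ≡⟨ cong (↔-sym τ •ᴵ_) (•ᴵ-cancelʳ σ i) ⟩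
  ↔-sym τ •ᴵ i           ∎
  where
  open ≡-Reasoning
  j = ↔-sym σ •ᴵ i

-- Where either coefficient is nonzero, the pulled-back index lies in I_p, so both permutations pull
-- `i` back to it. This later allows σ to be traded for an element of Sym(n).
•-agree : ∀ {p} (σ τ : ℕ ↔ ℕ) (u : ℤ^I c d) → ℤ^I⟨ p ⟩ u →
          (∀ {x} → x < p → Inverse.to σ x ≡ Inverse.to τ x) → σ • u ≈ τ • u
•-agree σ τ u u∈ σ≡τ i with coeff u (↔-sym σ •ᴵ i) ℤ.≟ 0ℤ | coeff u (↔-sym τ •ᴵ i) ℤ.≟ 0ℤ
... | yes σ≡0 | yes τ≡0 = trans σ≡0 (sym τ≡0)
... | no  σ≢0 | _       = cong (coeff u) (inverses-agree σ τ σ≡τ i (u∈ _ σ≢0))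
... | yes _   | no  τ≢0 = cong (coeff u) (sym (inverses-agree τ σ (sym ∘ σ≡τ) i (u∈ _ τ≢0)))

-- Lattices and spans

ℤ⟨⟩-isLattice : {A : Pred (ℤ^I c d) 0ℓ} → IsLattice ℤ⟨ A ⟩
ℤ⟨⟩-isLattice = record { resp-≈ = resp ; 𝟎-closed = zero ; ⊕-closed = add ; ⊖-closed = neg }

-- Stands in for induction on span membership: a property of every element of a span follows once it
-- defines a lattice that contains the generators.
ℤ⟨⟩-least : {A L : Pred (ℤ^I c d) 0ℓ} → IsLattice L → A ⊆ L → ℤ⟨ A ⟩ ⊆ L
ℤ⟨⟩-least {L = L} isL A⊆L = go
  where
  open IsLattice isL
  go : ℤ⟨ _ ⟩ ⊆ L
  go (gen a)      = A⊆L a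
  go zero         = 𝟎-closed
  go (add u∈ v∈)  = ⊕-closed (go u∈) (go v∈)
  go (neg u∈)     = ⊖-closed (go u∈)
  go (resp u≈v u∈) = resp-≈ u≈v (go u∈)

ℤ⟨⟩-mono : {A B : Pred (ℤ^I c d) 0ℓ} → A ⊆ B → ℤ⟨ A ⟩ ⊆ ℤ⟨ B ⟩
ℤ⟨⟩-mono A⊆B = ℤ⟨⟩-least ℤ⟨⟩-isLattice (gen ∘ A⊆B)

•-preimage-isLattice : (σ : ℕ ↔ ℕ) {L : Pred (ℤ^I c d) 0ℓ} → IsLattice L → IsLattice (L ∘ (σ •_))
•-preimage-isLattice σ isL = record
  { resp-≈   = λ {u} {v} u≈v → resp-≈ (•-cong σ {u} {v} u≈v)
  ; 𝟎-closed = resp-≈ (λ _ → refl) 𝟎-closed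
  ; ⊕-closed = λ u∈ v∈ → resp-≈ (λ _ → refl) (⊕-closed u∈ v∈)
  ; ⊖-closed = λ u∈ → resp-≈ (λ _ → refl) (⊖-closed u∈)
  }
  where open IsLattice isL

-- Only the components along `R` are compared. For empty `R` this is `≈`; for more than d distinct
-- rows it holds vacuously.
infix 4 _≡[_]_
_≡[_]_ : ℤ^I c d → List ℕ → ℤ^I c d → Set
u ≡[ R ] v = ∀ i → All (_∈ rows i) R → coeff u i ≡ coeff v i

too-many-rows : ∀ {R} (i : Index c d) → Unique R → d < length R → ¬ All (_∈ rows i) R
too-many-rows {d = d} {R} i@(is , _) R! d<R R∈i =
  ℕ.<⇒≱ d<R (ℕ.≤-trans (unique-length-≤ R! (All.lookup R∈i)) (ℕ.≤-reflexive (Vec.length-toList is)))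

-- Products of differences 1 - (a b)

Apart : ℕ × ℕ → ℕ × ℕ → Set
Apart (a , b) (a′ , b′) = (a ≢ a′ × a ≢ b′) × (b ≢ a′ × b ≢ b′)

-- The product of the elements 1 - (a b) of the integral group ring; the head of the list acts last.
∂ : List (ℕ × ℕ) → ℤ^I c d → ℤ^I c d
∂ []             u = u
∂ ((a , b) ∷ ps) u = ∂ ps u ⊕ (⊖ (transposition a b • ∂ ps u))

Avoids : Index c d → ℕ × ℕ → Set
Avoids i (a , b) = a ∉ rows i × b ∉ rows i

-- The factor of a pair avoiding `i` cancels because its transposition fixes `i`. Factors applied
-- after it replace `i` by an index that avoids the pair as well, since the pairs are disjoint.
∂-vanishes : ∀ {ps} → AllPairs Apart ps → ∀ (u : ℤ^I c d) i → Any (Avoids i) ps → coeff (∂ ps u) i ≡ 0ℤ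
∂-vanishes {ps = (a , b) ∷ ps} (_ ∷ _) u i (here (a∉ , b∉)) = begin
  coeff (∂ ps u) i ℤ.- coeff (∂ ps u) (transposition a b •ᴵ i) ≡⟨ cong (λ j → coeff (∂ ps u) i ℤ.- coeff (∂ ps u) j) (transposition-fixes i a∉ b∉) ⟩
  coeff (∂ ps u) i ℤ.- coeff (∂ ps u) i ≡⟨ ℤ.+-inverseʳ (coeff (∂ ps u) i) ⟩
  0ℤ ∎
  where open ≡-Reasoning
∂-vanishes {ps = (a , b) ∷ ps} (apart ∷ aparts) u i (there avoids) =
  cong₂ ℤ._-_ (∂-vanishes aparts u i avoids) (∂-vanishes aparts u (transposition a b •ᴵ i) (moved apart avoids))
  where
  notin : ∀ {x} → x ∉ rows i → a ≢ x → b ≢ x → x ∉ rows (transposition a b •ᴵ i)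
  notin x∉ a≢x b≢x x∈ with ∈-rows-•⁻ (transposition a b) i x∈
  ... | y , y∈ , x≡ with swap-cases a b y
  ... | inj₁ (_ , eq) = b≢x (sym (trans x≡ eq))
  ... | inj₂ (inj₁ (_ , eq)) = a≢x (sym (trans x≡ eq))
  ... | inj₂ (inj₂ (_ , _ , eq)) = x∉ (subst (_∈ rows i) (sym (trans x≡ eq)) y∈)
  moved : ∀ {qs} → All (Apart (a , b)) qs → Any (Avoids i) qs → Any (Avoids (transposition a b •ᴵ i)) qs
  moved (((a≢a′ , a≢b′) , (b≢a′ , b≢b′)) ∷ _) (here (a′∉ , b′∉)) = here (notin a′∉ a≢a′ b≢a′ , notin b′∉ a≢b′ b≢b′)
  moved (_ ∷ aps) (there avs) = there (moved aps avs)

-- Pigeonhole: a pair that does not avoid `i` contributes one of its rows to `R`, new because the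
-- pairs are disjoint from `R` and from each other. If the list runs out, `i` has more than d
-- distinct rows.
avoiding-pair : ∀ {R ps} (i : Index c d) → Unique R → All (_∈ rows i) R → AllPairs Apart ps →
                All (λ (a , b) → a ∉ R × b ∉ R) ps → d < length R + length ps → Any (Avoids i) ps
avoiding-pair {R = R} {[]} i R! R∈i _ _ d< =
  ⊥-elim (too-many-rows i R! (subst (_ <_) (ℕ.+-identityʳ (length R)) d<) R∈i)
avoiding-pair {d = d} {R = R} {(a , b) ∷ ps} i R! R∈i (apart ∷ aparts) ((a∉R , b∉R) ∷ ∉R) d<
  with a ∈? rows i | b ∈? rows i
... | no a∉  | no b∉ = here (a∉ , b∉)
... | yes a∈ | _     = there (avoiding-pair i (All.¬Any⇒All¬ _ a∉R ∷ R!) (a∈ ∷ R∈i) aparts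
        (All.zipWith (λ (((a≢a′ , a≢b′) , _) , a′∉R , b′∉R) → (λ { (here eq) → a≢a′ (sym eq) ; (there a′∈R) → a′∉R a′∈R })
                                                            , (λ { (here eq) → a≢b′ (sym eq) ; (there b′∈R) → b′∉R b′∈R })) (apart , ∉R))
        (subst (d <_) (ℕ.+-suc (length R) (length ps)) d<))
... | no _   | yes b∈ = there (avoiding-pair i (All.¬Any⇒All¬ _ b∉R ∷ R!) (b∈ ∷ R∈i) aparts
        (All.zipWith (λ ((_ , (b≢a′ , b≢b′)) , a′∉R , b′∉R) → (λ { (here eq) → b≢a′ (sym eq) ; (there a′∈R) → a′∉R a′∈R })
                                                            , (λ { (here eq) → b≢b′ (sym eq) ; (there b′∈R) → b′∉R b′∈R })) (apart , ∉R))
        (subst (d <_) (ℕ.+-suc (length R) (length ps)) d<))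

∂-≡[]-𝟎 : ∀ {R ps} (u : ℤ^I c d) → Unique R → AllPairs Apart ps → All (λ (a , b) → a ∉ R × b ∉ R) ps →
          d < length R + length ps → ∂ ps u ≡[ R ] 𝟎
∂-≡[]-𝟎 u R! aparts ∉R d< i R∈i = ∂-vanishes aparts u i (avoiding-pair i R! R∈i aparts ∉R d<)

All-zip⁺ : ∀ {P Q : Pred ℕ 0ℓ} {as bs} → All P as → All Q bs → All (λ (a , b) → P a × Q b) (zip as bs)
All-zip⁺ []         _          = []
All-zip⁺ (_ ∷ _)    []         = []
All-zip⁺ (pa ∷ pas) (qb ∷ qbs) = (pa , qb) ∷ All-zip⁺ pas qbs

zip-apart : ∀ {as bs} → Unique as → Unique bs → Disjoint as bs → AllPairs Apart (zip as bs)
zip-apart []         _          _   = []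
zip-apart (_ ∷ _)    []         _   = []
zip-apart {a ∷ as} {b ∷ bs} (a∉ ∷ as!) (b∉ ∷ bs!) dis =
  All.map (λ ((a≢a′ , b≢a′) , (a≢b′ , b≢b′)) → (a≢a′ , a≢b′) , (b≢a′ , b≢b′))
    (All-zip⁺ (All.zip (a∉ , All.tabulate λ { a′∈ refl → dis (there a′∈ , here refl) }))
              (All.zip (All.tabulate (λ { b′∈ refl → dis (here refl , there b′∈) }) , b∉)))
  ∷ zip-apart as! bs! (λ (∈as , ∈bs) → dis (there ∈as , there ∈bs))

-- Elimination of a row from the span of a set of translates

module Elimination {c d p : ℕ} (B : Pred (ℤ^I c d) 0ℓ) (B⊆ : B ⊆ ℤ^I⟨ p ⟩) where

  private
    variable
      F G : Pred (List ℕ) 0ℓ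

  -- The rows σ([p]), which contain all rows of `σ • b` for `b` in ℤ^(I_p). Conditions `F` on a
  -- translate are put on this list and not on its support, so that they depend on σ alone.
  image : ℕ ↔ ℕ → List ℕ
  image σ = map (Inverse.to σ) (upTo p)

  data Translate (F : Pred (List ℕ) 0ℓ) : Pred (ℤ^I c d) 0ℓ where
    translate : ∀ σ {u b} → B b → F (image σ) → u ≈ σ • b → Translate F u

  M : Pred (List ℕ) 0ℓ → Pred (ℤ^I c d) 0ℓ
  M F = ℤ⟨ Translate F ⟩

  M-mono : F ⊆ G → M F ⊆ M G
  M-mono F⊆G = ℤ⟨⟩-mono λ { (translate σ b∈ F[σ] eq) → translate σ b∈ (F⊆G F[σ]) eq }

  M-• : ∀ τ → (∀ {S} → F S → G (map (Inverse.to τ) S)) → ∀ {u} → M F u → M G (τ • u)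
  M-• {F} {G} τ F⇒G = ℤ⟨⟩-least {L = M G ∘ (τ •_)} (•-preimage-isLattice τ ℤ⟨⟩-isLattice) (λ {u} → on-gens {u})
    where
    on-gens : ∀ {u} → Translate F u → M G (τ • u)
    on-gens {u} (translate σ {b = b} b∈ F[σ] eq) = gen (translate (τ ↔-∘ σ) b∈
      (subst G (sym (List.map-∘ (upTo p))) (F⇒G F[σ]))
      (λ i → trans (•-cong τ {u} {σ • b} eq i) (sym (•-∘ τ σ b i))))

  _∖_ : Pred (List ℕ) 0ℓ → ℕ → Pred (List ℕ) 0ℓ
  (F ∖ t) S = F S × t ∉ S

  Missing : Pred (List ℕ) 0ℓ → List ℕ → Pred (List ℕ) 0ℓ
  Missing F ts S = F S × Any (_∉ S) ts

  translate-support : ∀ σ {b} → B b → ∀ i → coeff (σ • b) i ≢ 0ℤ → ∀ {x} → x ∈ rows i → x ∈ image σ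
  translate-support σ b∈ i ≢0 {x} x∈ =
    subst (_∈ image σ) (Inverse.strictlyInverseˡ σ x)
      (∈-map⁺ (Inverse.to σ) (∈-upTo⁺ (I⇒rows-< (↔-sym σ •ᴵ i) (B⊆ b∈ _ ≢0) (∈-rows-• (↔-sym σ) i x∈))))

  ∖-vanishes : ∀ {t u} → M (F ∖ t) u → ∀ i → t ∈ rows i → coeff u i ≡ 0ℤ
  ∖-vanishes {F} {t} = ℤ⟨⟩-least {L = Vanishes} isLattice (λ {u} → on-gens {u})
    where
    Vanishes : Pred (ℤ^I c d) 0ℓ
    Vanishes u = ∀ i → t ∈ rows i → coeff u i ≡ 0ℤ
    isLattice : IsLattice Vanishes
    isLattice = record
      { resp-≈   = λ {u} {v} u≈v u0 i t∈ → trans (sym (u≈v i)) (u0 i t∈)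
      ; 𝟎-closed = λ _ _ → refl
      ; ⊕-closed = λ u0 v0 i t∈ → cong₂ ℤ._+_ (u0 i t∈) (v0 i t∈)
      ; ⊖-closed = λ u0 i t∈ → cong ℤ.-_ (u0 i t∈)
      }
    on-gens : Translate (F ∖ t) ⊆ Vanishes
    on-gens (translate σ {b = b} b∈ (_ , t∉) eq) i t∈ with coeff (σ • b) i ℤ.≟ 0ℤ
    ... | yes ≡0 = trans (eq i) ≡0
    ... | no  ≢0 = contradiction (translate-support σ b∈ i ≢0 t∈) t∉

  -- Each generator misses `t` or a row of `ts`; the summands are grouped accordingly.
  Missing-split : ∀ {t ts u} → M (Missing F (t ∷ ts)) u →
                  ∃[ g ] ∃[ y ] M (F ∖ t) g × M (Missing F ts) y × u ≈ g ⊕ y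
  Missing-split {F} {t} {ts} = ℤ⟨⟩-least {L = Splits} isLattice (λ {u} → on-gens {u})
    where
    Splits : Pred (ℤ^I c d) 0ℓ
    Splits u = ∃[ g ] ∃[ y ] M (F ∖ t) g × M (Missing F ts) y × u ≈ g ⊕ y
    isLattice : IsLattice Splits
    isLattice = record
      { resp-≈   = λ u≈v (g , y , g∈ , y∈ , eq) → g , y , g∈ , y∈ , λ i → trans (sym (u≈v i)) (eq i)
      ; 𝟎-closed = 𝟎 , 𝟎 , zero , zero , λ _ → refl
      ; ⊕-closed = λ (g , y , g∈ , y∈ , eq) (g′ , y′ , g′∈ , y′∈ , eq′) →
          g ⊕ g′ , y ⊕ y′ , add g∈ g′∈ , add y∈ y′∈ ,
          λ i → trans (cong₂ ℤ._+_ (eq i) (eq′ i)) (interchange (coeff g i) (coeff y i) (coeff g′ i) (coeff y′ i))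
      ; ⊖-closed = λ (g , y , g∈ , y∈ , eq) → ⊖ g , ⊖ y , neg g∈ , neg y∈ ,
          λ i → trans (cong ℤ.-_ (eq i)) (ℤ.neg-distrib-+ (coeff g i) (coeff y i))
      }
      where
      interchange : ∀ a b a′ b′ → (a ℤ.+ b) ℤ.+ (a′ ℤ.+ b′) ≡ (a ℤ.+ a′) ℤ.+ (b ℤ.+ b′)
      interchange = solve-∀
    on-gens : Translate (Missing F (t ∷ ts)) ⊆ Splits
    on-gens {u} (translate σ b∈ (F[σ] , here t∉) eq) =
      u , 𝟎 , gen (translate σ b∈ (F[σ] , t∉) eq) , zero , λ i → sym (ℤ.+-identityʳ (coeff u i))
    on-gens {u} (translate σ b∈ (F[σ] , there m) eq) =
      𝟎 , u , zero , gen (translate σ b∈ (F[σ] , m) eq) , λ i → sym (ℤ.+-identityˡ (coeff u i))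

  -- Makes the rows of `cs` freely available: rows of a translate may be dropped or replaced by core
  -- rows without leaving `F`.
  CoreClosed : List ℕ → Pred (List ℕ) 0ℓ → Set
  CoreClosed cs F = ∀ {S S′} → F S → (∀ {x} → x ∈ S′ → x ∈ S ⊎ x ∈ cs) → F S′

  ∈-map-swap : ∀ {a b x} S → x ∈ map (swap a b) S → x ∈ S ⊎ (x ≡ b × a ∈ S) ⊎ (x ≡ a × b ∈ S)
  ∈-map-swap {a} {b} S x∈ with ∈-map⁻ (swap a b) x∈
  ... | y , y∈ , x≡ with swap-cases a b y
  ... | inj₁ (refl , eq)             = inj₂ (inj₁ (trans x≡ eq , y∈))
  ... | inj₂ (inj₁ (refl , eq))      = inj₂ (inj₂ (trans x≡ eq , y∈))
  ... | inj₂ (inj₂ (_ , _ , eq))     = inj₁ (subst (_∈ S) (sym (trans x≡ eq)) y∈)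

  -- As `b` is absent from `S`, the swap replaces any `a` by the core row `b`, so `a` disappears.
  swap-∖ : ∀ {cs a b} → CoreClosed cs F → b ∈ cs →
           ∀ {S} → (F ∖ b) S → (F ∖ a) (map (swap a b) S)
  swap-∖ {a = a} {b} closed b∈ {S} (FS , b∉) =
    closed FS (λ x∈ → case ∈-map-swap S x∈ of λ where
      (inj₁ x∈S)                  → inj₁ x∈S
      (inj₂ (inj₁ (refl , _)))    → inj₂ b∈
      (inj₂ (inj₂ (_ , b∈S)))     → contradiction b∈S b∉) ,
    λ a∈ → case ∈-map⁻ (swap a b) a∈ of λ (y , y∈ , a≡) → case swap-cases a b y of λ where
      (inj₁ (refl , eq))          → b∉ (subst (_∈ S) (trans a≡ eq) y∈)
      (inj₂ (inj₁ (refl , _)))    → b∉ y∈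
      (inj₂ (inj₂ (y≢a , _ , eq))) → y≢a (sym (trans a≡ eq))

  ∂-closed : ∀ {H : Pred (List ℕ) 0ℓ} {ps} → All (λ (a , b) → ∀ {S} → H S → H (map (swap a b) S)) ps →
             ∀ {u} → M H u → M H (∂ ps u)
  ∂-closed []         u∈ = u∈
  ∂-closed {H} {(a , b) ∷ ps} (cl ∷ cls) u∈ =
    add (∂-closed cls u∈) (neg (M-• {G = H} (transposition a b) cl (∂-closed cls u∈)))

  -- Only the first transposition may involve a row outside cs, and it is
  -- applied last, to sets from which its partner b is still absent.
  ∂-expand : ∀ {cs} → CoreClosed cs F → ∀ σ {v a b ps} → B v → F (image σ) →
             b ∈ cs → All (λ (a , b) → a ∈ cs × b ∈ cs) ps →
             AllPairs Apart ((a , b) ∷ ps) →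
             b ∉ image σ → All (λ (_ , b) → b ∉ image σ) ps →
             M (Missing F (map proj₁ ((a , b) ∷ ps))) ((σ • v) ⊕ (⊖ (∂ ((a , b) ∷ ps) (σ • v))))
  ∂-expand {F} {cs} closed σ {v} {a} {b} {ps} v∈ F[σ] b∈ ps∈ (apart ∷ aparts) b∉ ps∉ =
    -- Uses x - (y - τy) = (x - y) + τy: the first part is the same statement for `ps`, and τy
    -- misses `a` because y misses `b`.
    resp (λ i → regroup (coeff x i) (coeff y i) (coeff (τ • y) i))
      (add (M-mono (λ (FS , m) → FS , there m) (tail-expand ps∈ aparts ps∉))
           (M-mono (λ (FS , a∉) → FS , here a∉) (M-• {F ∖ b} {F ∖ a} τ (swap-∖ closed b∈) y∈)))
    where
    x = σ • v
    y = ∂ ps x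
    τ = transposition a b
    regroup : ∀ x y z → (x ℤ.- y) ℤ.+ z ≡ x ℤ.- (y ℤ.- z)
    regroup = solve-∀
    tail-expand : ∀ {ps} → All (λ (a , b) → a ∈ cs × b ∈ cs) ps → AllPairs Apart ps →
                  All (λ (_ , b) → b ∉ image σ) ps → M (Missing F (map proj₁ ps)) (x ⊕ (⊖ (∂ ps x)))
    tail-expand []                 _      _          = resp (λ i → sym (ℤ.+-inverseʳ (coeff x i))) zero
    tail-expand ((_ , b∈) ∷ ps∈) aparts (b∉ ∷ ps∉) = ∂-expand closed σ v∈ F[σ] b∈ ps∈ aparts b∉ ps∉
    y∈ : M (F ∖ b) y
    y∈ = ∂-closed (All.zipWith keeps (ps∈ , apart)) (gen (translate σ v∈ (F[σ] , b∉) λ _ → refl))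
      where
      keeps : ∀ {p} → (proj₁ p ∈ cs × proj₂ p ∈ cs) × Apart (a , b) p →
              ∀ {S} → (F ∖ b) S → (F ∖ b) (map (swap (proj₁ p) (proj₂ p)) S)
      keeps ((a′∈ , b′∈) , _ , (b≢a′ , b≢b′)) {S} (FS , b∉S) =
        closed FS (λ x∈ → case ∈-map-swap S x∈ of λ where
          (inj₁ x∈S)               → inj₁ x∈S
          (inj₂ (inj₁ (refl , _))) → inj₂ b′∈
          (inj₂ (inj₂ (refl , _))) → inj₂ a′∈) ,
        λ b∈S → case ∈-map-swap S b∈S of λ where
          (inj₁ b∈S)              → b∉S b∈S
          (inj₂ (inj₁ (b≡b′ , _))) → b≢b′ b≡b′
          (inj₂ (inj₂ (b≡a′ , _))) → b≢a′ b≡a′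

  Any-zip⁻ : ∀ {P : Pred ℕ 0ℓ} as (bs : List ℕ) → Any P (map proj₁ (zip as bs)) → Any P as
  Any-zip⁻ (_ ∷ _)  (_ ∷ _)  (here pa)  = here pa
  Any-zip⁻ (_ ∷ as) (_ ∷ bs) (there pas) = there (Any-zip⁻ as bs pas)

  -- The product of the differences 1 - (a b), for a in t ∷ T and fresh b in
  -- rest, kills the part of ℤ^(I) involving R.
  make-missing : ∀ {R t T rest} → CoreClosed (T ++ rest) F → Unique (t ∷ T) → Unique rest → Unique R →
                 Disjoint (t ∷ T) R → Disjoint rest R → Disjoint (t ∷ T) rest →
                 d < length R + suc (length T) → p + suc (length T) ≤ length rest →
                 ∀ {u} → M F u → ∃[ u′ ] M (Missing F (t ∷ T)) u′ × u ≡[ R ] u′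
  make-missing {F} {R} {t} {T} {rest} closed tT! rest! R! tT#R rest#R tT#rest d< p+ =
    ℤ⟨⟩-least {L = Reduces} isLattice (λ {u} → on-gens {u})
    where
    Reduces : Pred (ℤ^I c d) 0ℓ
    Reduces u = ∃[ u′ ] M (Missing F (t ∷ T)) u′ × u ≡[ R ] u′
    isLattice : IsLattice Reduces
    isLattice = record
      { resp-≈   = λ u≈v (u′ , u′∈ , eq) → u′ , u′∈ , λ i R∈ → trans (sym (u≈v i)) (eq i R∈)
      ; 𝟎-closed = 𝟎 , zero , λ _ _ → refl
      ; ⊕-closed = λ (u′ , u′∈ , eq) (v′ , v′∈ , eq′) → u′ ⊕ v′ , add u′∈ v′∈ , λ i R∈ → cong₂ ℤ._+_ (eq i R∈) (eq′ i R∈)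
      ; ⊖-closed = λ (u′ , u′∈ , eq) → ⊖ u′ , neg u′∈ , λ i R∈ → cong ℤ.-_ (eq i R∈)
      }
    length-image : ∀ σ → length (image σ) ≡ p
    length-image σ = trans (List.length-map (Inverse.to σ) (upTo p)) (List.length-upTo p)
    on-gens : Translate F ⊆ Reduces
    -- `image σ` has `p` rows and `rest` at least p + |T| + 1, enough for one partner outside
    -- `image σ` for each row of `t ∷ T`.
    on-gens {u} (translate σ {b = v} v∈ F[σ] u≈) with fresh (suc (length T)) (image σ) rest!
      (subst (λ m → m + suc (length T) ≤ length rest) (sym (length-image σ)) p+)
    ... | b ∷ bs , |bs|≡ , b∷bs!@(b∉bs ∷ bs!) , b∷bs#S , b∷bs⊆ = x ⊕ (⊖ y) ,
        M-mono (λ (FS , m) → FS , Any-zip⁻ (t ∷ T) (b ∷ bs) m)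
          (∂-expand closed σ v∈ F[σ] (∈-++⁺ʳ T (b∷bs⊆ (here refl)))
            (All-zip⁺ (All.tabulate ∈-++⁺ˡ) (All.tabulate (∈-++⁺ʳ T ∘ b∷bs⊆ ∘ there)))
            aparts
            (λ b∈S → b∷bs#S (here refl , b∈S))
            (All.map proj₂ (All-zip⁺ {P = _∈ T} (All.tabulate id) (All.tabulate (λ b∈ b∈S → b∷bs#S (there b∈ , b∈S)))))) ,
        λ i R∈ → trans (u≈ i) (trans (sym (ℤ.+-identityʳ (coeff x i)))
                   (cong (λ z → coeff x i ℤ.- z) (sym (y≡𝟎 i R∈))))
      where
      ps = zip (t ∷ T) (b ∷ bs)
      x = σ • v
      y = ∂ ps x
      tT#bs : Disjoint (t ∷ T) (b ∷ bs)
      tT#bs (∈tT , ∈bs) = tT#rest (∈tT , b∷bs⊆ ∈bs)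
      aparts : AllPairs Apart ps
      aparts = zip-apart tT! b∷bs! tT#bs
      length-ps : length ps ≡ suc (length T)
      length-ps = trans (List.length-zipWith _,_ (t ∷ T) (b ∷ bs)) (trans (cong (suc (length T) ⊓_) |bs|≡) (ℕ.⊓-idem _))
      y≡𝟎 : y ≡[ R ] 𝟎
      y≡𝟎 = ∂-≡[]-𝟎 x R! aparts
        (All-zip⁺ (All.tabulate λ a∈ a∈R → tT#R (a∈ , a∈R)) (All.tabulate λ b∈ b∈R → rest#R (b∷bs⊆ b∈ , b∈R)))
        (subst (λ m → d < length R + m) (sym length-ps) d<)

  -- Both v and (t s) v vanish at the indices that involve R and one of t, s.
  exchange : ∀ {cs R t s} → CoreClosed cs F → s ∈ cs → t ∉ R → s ∉ R →
             ∀ {v} → M (F ∖ s) v → v ≡[ t ∷ R ] 𝟎 → M (F ∖ t) (transposition t s • v) × v ≡[ R ] transposition t s • v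
  exchange {F} {R = R} {t} {s} closed s∈ t∉R s∉R {v} v∈ v≡𝟎 =
    M-• {F ∖ s} {F ∖ t} (transposition t s) (swap-∖ closed s∈) v∈ , agree
    where
    τ = transposition t s
    vanishes : ∀ i → All (_∈ rows i) R → t ∈ rows i ⊎ s ∈ rows i → coeff v i ≡ 0ℤ
    vanishes i R∈ (inj₁ t∈) = v≡𝟎 i (t∈ ∷ R∈)
    vanishes i R∈ (inj₂ s∈) = ∖-vanishes v∈ i s∈
    R∈τ : ∀ i → All (_∈ rows i) R → All (_∈ rows (τ •ᴵ i)) R
    R∈τ i R∈ = All.tabulate λ {r} r∈ → subst (_∈ rows (τ •ᴵ i))
      (swap-other (λ { refl → t∉R r∈ }) (λ { refl → s∉R r∈ })) (∈-rows-• τ i (All.lookup R∈ r∈))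
    agree : v ≡[ R ] τ • v
    agree i R∈ with t ∈? rows i | s ∈? rows i
    ... | no t∉  | no s∉ = cong (coeff v) (sym (transposition-fixes i t∉ s∉))
    ... | yes t∈ | _     = trans (vanishes i R∈ (inj₁ t∈)) (sym (vanishes (τ •ᴵ i) (R∈τ i R∈)
            (inj₂ (subst (_∈ rows (τ •ᴵ i)) (swap-left t s) (∈-rows-• τ i t∈)))))
    ... | no _   | yes s∈ = trans (vanishes i R∈ (inj₂ s∈)) (sym (vanishes (τ •ᴵ i) (R∈τ i R∈)
            (inj₁ (subst (_∈ rows (τ •ᴵ i)) (swap-right t s) (∈-rows-• τ i s∈)))))

  -- A row of `ts` missing from `S` cannot return from `rest`, which is disjoint from `ts`; hence
  -- the core shrinks to `rest`.
  CoreClosed-Missing : ∀ {cs rest ts} → CoreClosed cs F → (∀ {x} → x ∈ rest → x ∈ cs) → Disjoint ts rest →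
                       CoreClosed rest (Missing F ts)
  CoreClosed-Missing closed rest⊆ ts#rest (FS , missing) S′⊆ =
    closed FS (λ x∈ → case S′⊆ x∈ of λ where
      (inj₁ x∈S)    → inj₁ x∈S
      (inj₂ x∈rest) → inj₂ (rest⊆ x∈rest)) ,
    still-missing missing ts#rest
    where
    still-missing : ∀ {ts} → Any _ ts → Disjoint ts _ → Any _ ts
    still-missing (here s∉S) dis = here λ s∈S′ → case S′⊆ s∈S′ of λ where
      (inj₁ s∈S)    → s∉S s∈S
      (inj₂ s∈rest) → dis (here refl , s∈rest)
    still-missing (there m) dis = there (still-missing m λ (∈ts , ∈rest) → dis (there ∈ts , ∈rest))

  -- Core rows for `eliminate` with parameter `suc e`: `e` rows form `T`; the others form `rest`,
  -- which provides `suc e` partners outside an image of size `p` and has `need e` rows to serve as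
  -- core of the recursive calls.
  need : ℕ → ℕ
  need zero    = 0
  need (suc e) = e + (p + suc e + need e)

  -- Induction on `k`, the number of rows by which `R` falls short of d + 1; `R` holds rows that an
  -- index is already required to contain. Along `R`, u is rewritten as `g`, which misses `t`, plus
  -- `y`, whose translates each miss a row of `T`. `distribute` treats these rows `s` one at a time,
  -- and its recursive call eliminates `s` along the longer list `t ∷ R`.
  eliminate : ∀ k {R t cs} → length R + k ≡ suc d → Unique (t ∷ R) → Unique cs → Disjoint cs (t ∷ R) →
              need k ≤ length cs → CoreClosed cs F →
              ∀ {u} → M F u → u ≡[ t ∷ R ] 𝟎 → ∃[ u′ ] M (F ∖ t) u′ × u ≡[ R ] u′
  eliminate zero {R} |R|≡ (_ ∷ R!) _ _ _ _ _ _ =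
    -- `R` has d + 1 distinct rows, so no index contains all of them.
    𝟎 , zero , λ i R∈ → ⊥-elim (too-many-rows i R! (ℕ.≤-reflexive (trans (sym |R|≡) (ℕ.+-identityʳ (length R)))) R∈)
  eliminate {F} (suc e) {R} {t} {cs} |R|+k≡ (t∉R ∷ R!) cs! cs#tR need≤ closed {u} u∈ u≡𝟎 =
    -- `t ∷ T` has e + 1 rows, so |R| plus the number of differences is d + 1, one more than an
    -- index can meet. As `u₁` and `g` vanish along `t ∷ R`, so does `y`.
    let u₁ , u₁∈ , u≡u₁     = make-missing closed′ tT! (drop⁺ e cs!) R! tT#R rest#R tT#rest d< p+ u∈
        g , y , g∈ , y∈ , u₁≈ = Missing-split u₁∈
        w , w∈ , y≡w        = distribute T (take⁺ e cs!) (∈-take⁻ e cs) (take-drop-disjoint e cs!) y∈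
                                (remainder {u₁} {g} {y} g∈ u₁≈
                                  λ { i (t∈ ∷ R∈) → trans (sym (u≡u₁ i R∈)) (u≡𝟎 i (t∈ ∷ R∈)) })
    in  g ⊕ w , add g∈ w∈ , λ i R∈ →
          trans (u≡u₁ i R∈) (trans (u₁≈ i) (cong (λ x → coeff g i ℤ.+ x) (y≡w i R∈)))
    where
    T    = take e cs
    rest = drop e cs
    |T|≡e : length T ≡ e
    |T|≡e = trans (List.length-take e cs) (ℕ.m≤n⇒m⊓n≡m (ℕ.m+n≤o⇒m≤o e need≤))
    rest≥ : p + suc e + need e ≤ length rest
    rest≥ = subst (p + suc e + need e ≤_) (sym (List.length-drop e cs))
              (subst (_≤ length cs ∸ e) (ℕ.m+n∸m≡n e _) (ℕ.∸-monoˡ-≤ e need≤))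
    closed′ : CoreClosed (T ++ rest) F
    closed′ = subst (λ xs → CoreClosed xs F) (sym (List.take++drop≡id e cs)) closed
    tT! : Unique (t ∷ T)
    tT! = All.tabulate (λ { s∈ refl → cs#tR (∈-take⁻ e cs s∈ , here refl) }) ∷ take⁺ e cs!
    tT#R : Disjoint (t ∷ T) R
    tT#R (here refl , t∈R) = All.lookup t∉R t∈R refl
    tT#R (there s∈ , s∈R)  = cs#tR (∈-take⁻ e cs s∈ , there s∈R)
    rest#R : Disjoint rest R
    rest#R (s∈ , s∈R) = cs#tR (∈-drop⁻ e cs s∈ , there s∈R)
    tT#rest : Disjoint (t ∷ T) rest
    tT#rest (here refl , t∈)     = cs#tR (∈-drop⁻ e cs t∈ , here refl)
    tT#rest (there s∈ , s∈rest) = take-drop-disjoint e cs! (s∈ , s∈rest)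
    d< : d < length R + suc (length T)
    d< = subst (λ m → d < length R + suc m) (sym |T|≡e) (ℕ.≤-reflexive (sym |R|+k≡))
    p+ : p + suc (length T) ≤ length rest
    p+ = subst (λ m → p + suc m ≤ length rest) (sym |T|≡e) (ℕ.m+n≤o⇒m≤o (p + suc e) rest≥)
    remainder : ∀ {v g y r Q} → M (F ∖ r) g → v ≈ g ⊕ y → v ≡[ r ∷ Q ] 𝟎 → y ≡[ r ∷ Q ] 𝟎
    remainder {v} {g} {y} g∈ v≈ v≡𝟎 i (r∈ ∷ Q∈) = begin
      coeff y i                  ≡⟨ ℤ.+-identityˡ (coeff y i) ⟨
      0ℤ ℤ.+ coeff y i           ≡⟨ cong (ℤ._+ coeff y i) (∖-vanishes g∈ i r∈) ⟨
      coeff g i ℤ.+ coeff y i    ≡⟨ v≈ i ⟨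
      coeff v i                  ≡⟨ v≡𝟎 i (r∈ ∷ Q∈) ⟩
      0ℤ                         ∎
      where open ≡-Reasoning
    regroup : ∀ a b x → a ℤ.+ b ≡ (a ℤ.+ x) ℤ.+ (b ℤ.- x)
    regroup = solve-∀
    -- The summand y₁ missing s and the rest y₂ cancel along t ∷ R, so there
    -- both miss s; eliminating s from y₂ yields z with y₁ + z and y₂ - z
    -- vanishing along t ∷ R separately.
    distribute : ∀ ts → Unique ts → (∀ {s} → s ∈ ts → s ∈ cs) → Disjoint ts rest →
                 ∀ {y} → M (Missing F ts) y → y ≡[ t ∷ R ] 𝟎 → ∃[ w ] M (F ∖ t) w × y ≡[ R ] w
    -- No translate misses a row of the empty list, so `y` is in the span of the empty set and
    -- belongs to every `M`.
    distribute []       _            _   _       {y} y∈ _   = y , M-mono (λ ()) y∈ , λ _ _ → refl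
    distribute (s ∷ ts) (s∉ts ∷ ts!) ts⊆ ts#rest {y} y∈ y≡𝟎 =
      let y₁ , y₂ , y₁∈ , y₂∈ , y≈ = Missing-split y∈
          z , z∈ , y₂≡z = eliminate e (trans (sym (ℕ.+-suc (length R) e)) |R|+k≡) stR! (drop⁺ e cs!) rest#stR
                            (ℕ.m+n≤o⇒n≤o (p + suc e) rest≥)
                            (CoreClosed-Missing closed (∈-drop⁻ e cs) ts#rest′)
                            y₂∈ (remainder {y} {y₁} {y₂} y₁∈ y≈ λ { i (_ ∷ tR∈) → y≡𝟎 i tR∈ })
          w₁∈ , ≡w₁     = exchange closed s∈cs (λ t∈R → All.lookup t∉R t∈R refl) (λ s∈R → cs#tR (s∈cs , there s∈R))
                            (add y₁∈ (M-mono (λ ((FS , _) , s∉) → FS , s∉) z∈))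
                            (λ i tR∈ → trans (cong (λ x → coeff y₁ i ℤ.+ x) (sym (y₂≡z i tR∈))) (trans (sym (y≈ i)) (y≡𝟎 i tR∈)))
          w₂ , w₂∈ , ≡w₂ = distribute ts ts! (ts⊆ ∘ there) ts#rest′
                            (add y₂∈ (neg (M-mono proj₁ z∈)))
                            (λ i tR∈ → trans (cong (λ x → x ℤ.- coeff z i) (y₂≡z i tR∈)) (ℤ.+-inverseʳ (coeff z i)))
      in  _ , add w₁∈ w₂∈ , λ i R∈ →
            trans (y≈ i) (trans (regroup (coeff y₁ i) (coeff y₂ i) (coeff z i)) (cong₂ ℤ._+_ (≡w₁ i R∈) (≡w₂ i R∈)))
      where
      s∈cs : s ∈ cs
      s∈cs = ts⊆ (here refl)
      stR! : Unique (s ∷ t ∷ R)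
      stR! = All.tabulate (λ { r∈ refl → cs#tR (s∈cs , r∈) }) ∷ t∉R ∷ R!
      rest#stR : Disjoint rest (s ∷ t ∷ R)
      rest#stR (s∈rest , here refl) = ts#rest (here refl , s∈rest)
      rest#stR (r∈rest , there r∈)  = cs#tR (∈-drop⁻ e cs r∈rest , r∈)
      ts#rest′ : Disjoint ts rest
      ts#rest′ (∈ts , ∈rest) = ts#rest (there ∈ts , ∈rest)

  -- The rows n, n + 1, …, N - 1 are eliminated from the top; the core is [n].
  descend : ∀ {n} → need (suc d) ≤ n → ∀ k {u} → ℤ^I⟨ n ⟩ u → M (All (_< k + n)) u → M (All (_< n)) u
  descend         need≤ zero        _   u∈ = u∈
  descend {n = n} need≤ (suc k) {u} inI u∈ =
    -- With `R` empty, the parameter of `eliminate` is d + 1 and the agreement obtained is `≈`, so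
    -- the row k + n is eliminated from `u` itself.
    let _ , u′∈ , u≡u′ = eliminate (suc d) refl ([] ∷ []) (upTo⁺ n) core# core≥ core-closed u∈ vanishes
    in  descend need≤ k inI (M-mono lower (resp (λ i → sym (u≡u′ i [])) u′∈))
    where
    core# : Disjoint (upTo n) (k + n ∷ [])
    core# (k+n∈ , here refl) = ℕ.<⇒≱ (∈-upTo⁻ k+n∈) (ℕ.m≤n+m n k)
    core≥ : need (suc d) ≤ length (upTo n)
    core≥ = subst (need (suc d) ≤_) (sym (List.length-upTo n)) need≤
    core-closed : CoreClosed (upTo n) (All (_< suc k + n))
    core-closed S< S′⊆ = All.tabulate λ x∈ → case S′⊆ x∈ of λ where
      (inj₁ x∈S)  → All.lookup S< x∈S
      (inj₂ x∈cs) → ℕ.<-≤-trans (∈-upTo⁻ x∈cs) (ℕ.m≤n+m n (suc k))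
    vanishes : u ≡[ k + n ∷ [] ] 𝟎
    vanishes i (k+n∈ ∷ []) with coeff u i ℤ.≟ 0ℤ
    ... | yes ≡0 = ≡0
    ... | no  ≢0 = contradiction (ℕ.m≤n+m n k) (ℕ.<⇒≱ (I⇒rows-< i (inI i ≢0) k+n∈))
    lower : (All (_< suc k + n) ∖ (k + n)) ⊆ All (_< k + n)
    lower (S< , k+n∉) = All.tabulate λ x∈ → case ℕ.m<1+n⇒m<n∨m≡n (All.lookup S< x∈) of λ where
      (inj₁ x<)   → x<
      (inj₂ refl) → contradiction x∈ k+n∉

  -- A finite sum of translates lies in `M (All (_< N))` for some N, and `descend` lowers the bound
  -- to `n`. A permutation that maps [p] into [n] agrees there with an element of Sym(n). The group
  -- `G` is arbitrary because both Sym and larger Sym(m) occur.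
  saturated : ∀ {G n} → p ≤ n → need (suc d) ≤ n → ℤ⟨ G [ B ] ⟩ ∩ ℤ^I⟨ n ⟩ ⊆ ℤ⟨ Sym⟨ n ⟩ [ B ] ⟩
  saturated {G} {n} p≤n need≤ (u∈ , inI) with bounded-rows u∈
    where
    Bounded : Pred (ℤ^I c d) 0ℓ
    Bounded u = ∃[ N ] M (All (_< N)) u
    isLattice : IsLattice Bounded
    isLattice = record
      { resp-≈   = λ u≈v (N , u∈) → N , resp u≈v u∈
      ; 𝟎-closed = 0 , zero
      ; ⊕-closed = λ (N , u∈) (N′ , v∈) → N ⊔ N′ ,
          add (M-mono (All.map λ x< → ℕ.<-≤-trans x< (ℕ.m≤m⊔n N N′)) u∈) (M-mono (All.map λ x< → ℕ.<-≤-trans x< (ℕ.m≤n⊔m N N′)) v∈)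
      ; ⊖-closed = λ (N , u∈) → N , neg u∈
      }
    bounded-rows : ℤ⟨ G [ B ] ⟩ ⊆ Bounded
    bounded-rows = ℤ⟨⟩-least isLattice λ (σ , b , _ , b∈ , eq) →
      suc (max 0 (image σ)) , gen (translate σ b∈ (All.map s≤s (xs≤max 0 (image σ))) eq)
  ... | N , u∈M = ℤ⟨⟩-mono realise (descend need≤ N inI (M-mono (All.map λ x< → ℕ.<-≤-trans x< (ℕ.m≤m+n N n)) u∈M))
    where
    realise : Translate (All (_< n)) ⊆ Sym⟨ n ⟩ [ B ]
    realise (translate σ {b = b} b∈ S< eq)
      with restrict-Sym σ p p≤n (λ i<p → All.lookup S< (∈-map⁺ (Inverse.to σ) (∈-upTo⁺ i<p)))
    ... | τ , τ∈ , τ≡σ = τ , b , τ∈ , b∈ , λ i → trans (eq i) (sym (•-agree τ σ b (B⊆ b∈) τ≡σ i))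

-- Supports

index-vectors : ∀ d → ℕ → List (Vec.Vec ℕ d)
index-vectors zero    n = Vec.[] ∷ []
index-vectors (suc d) n = cartesianProductWith Vec._∷_ (upTo n) (index-vectors d n)

∈-index-vectors : ∀ {n} {is : Vec.Vec ℕ d} → VecAll.All (_< n) is → is ∈ index-vectors d n
∈-index-vectors VecAll.[]          = here refl
∈-index-vectors (i<n VecAll.∷ is<n) = ∈-cartesianProductWith⁺ Vec._∷_ (∈-upTo⁺ i<n) (∈-index-vectors is<n)

indices : ℕ → List (Index c d)
indices {c} {d} n = cartesianProduct (index-vectors d n) (allFin c)

∈-indices : ∀ {n} (i : Index c d) → I⟨ n ⟩ i → i ∈ indices n
∈-indices (is , j) is<n = ∈-cartesianProduct⁺ (∈-index-vectors is<n) (∈-allFin j)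

support : ℤ^I c d → List (Index c d)
support u = filter (λ i → ¬? (coeff u i ℤ.≟ 0ℤ)) (deduplicate _≟ᴵ_ (bound u))

∈-support⁺ : (u : ℤ^I c d) → ∀ i → coeff u i ≢ 0ℤ → i ∈ support u
∈-support⁺ u i ≢0 = ∈-filter⁺ _ (∈-deduplicate⁺ _≟ᴵ_ (bounded u i ≢0)) ≢0

∈-support⁻ : (u : ℤ^I c d) → ∀ {i} → i ∈ support u → coeff u i ≢ 0ℤ
∈-support⁻ u i∈ = proj₂ (∈-filter⁻ (λ i → ¬? (coeff u i ℤ.≟ 0ℤ)) {xs = deduplicate _≟ᴵ_ (bound u)} i∈)

supportSize-≤ : (u : ℤ^I c d) → ∀ {K} → (∀ i → coeff u i ≢ 0ℤ → i ∈ K) → supportSize u ≤ length K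
supportSize-≤ u u⊆K = unique-length-≤ (filter⁺ _ (deduplicate-! (bound u))) (λ {i} i∈ → u⊆K i (∈-support⁻ u i∈))
  where open DecUnique _≟ᴵ_ using (deduplicate-!)

support-rows : ℤ^I c d → List ℕ
support-rows u = concatMap rows (support u)

length-support-rows : (u : ℤ^I c d) → length (support-rows u) ≡ supportSize u * d
length-support-rows {d = d} u = go (support u)
  where
  go : ∀ is → length (concatMap rows is) ≡ length is * d
  go []             = refl
  go (i@(v , _) ∷ is) = trans (List.length-++ (rows i)) (cong₂ _+_ (Vec.length-toList v) (go is))

-- If σ sends `x` to `l = length xs` or beyond, a swap with `l` brings it to `l`; the rows gathered
-- before have values below `l` and are left alone.
gather : ∀ xs → ∃[ σ ] Sym σ × (∀ {x} → x ∈ xs → Inverse.to σ x < length xs)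
gather []       = ↔-id ℕ , (0 , λ _ _ → refl) , λ ()
gather (x ∷ xs) with gather xs
... | σ , (n , σ∈) , σ< with Inverse.to σ x ℕ.<? length xs
...   | yes σx< = σ , (n , σ∈) , λ where
        (here refl) → ℕ.m<n⇒m<1+n σx<
        (there y∈)  → ℕ.m<n⇒m<1+n (σ< y∈)
...   | no  σx≮ = τ ↔-∘ σ , (N , fixes) , λ where
        (here refl) → ℕ.≤-reflexive (cong suc (swap-left a l))
        (there y∈)  → ℕ.m<n⇒m<1+n (subst (_< l) (sym (swap-other (unmoved y∈) (ℕ.<⇒≢ (σ< y∈)))) (σ< y∈))
  where
  a = Inverse.to σ x
  l = length xs
  τ = transposition a l
  N = n ⊔ suc (a ⊔ l)
  fixes : Sym⟨ N ⟩ (τ ↔-∘ σ)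
  fixes i N≤i = trans (cong (swap a l) (σ∈ i (ℕ.≤-trans (ℕ.m≤m⊔n n _) N≤i)))
    (swap-Sym (s≤s (ℕ.m≤m⊔n a l)) (s≤s (ℕ.m≤n⊔m a l)) i (ℕ.≤-trans (ℕ.m≤n⊔m n _) N≤i))
  unmoved : ∀ {y} → y ∈ xs → Inverse.to σ y ≢ a
  unmoved y∈ eq = σx≮ (subst (_< l) eq (σ< y∈))

compress : (u : ℤ^I c d) → ∃[ σ ] Sym σ × ℤ^I⟨ supportSize u * d ⟩ (σ • u)
compress u with gather (support-rows u)
... | σ , σ∈ , σ< = σ , σ∈ , λ i ≢0 → rows-<⇒I i λ {x} x∈ →
  subst (_< _) (Inverse.strictlyInverseˡ σ x) (subst (_ <_) (length-support-rows u)
    (σ< (∈-concatMap⁺ rows (Any.map (λ { refl → ∈-rows-• (↔-sym σ) i x∈ }) (∈-support⁺ u (↔-sym σ •ᴵ i) ≢0)))))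

-- Subgroups of ℤ^k are finitely generated

infixr 7 _⊙_
_⊙_ : ℤ → ℤ^I c d → ℤ^I c d
coeff   (z ⊙ u) i    = z ℤ.* coeff u i
bound   (z ⊙ u)      = bound u
bounded (z ⊙ u) i ≢0 = bounded u i λ u≡0 → ≢0 (trans (cong (z ℤ.*_) u≡0) (ℤ.*-zeroʳ z))

⊙-closed : {L : Pred (ℤ^I c d) 0ℓ} → IsLattice L → ∀ {u} → L u → ∀ z → L (z ⊙ u)
⊙-closed {L = L} isL {u} u∈ = go
  where
  open IsLattice isL
  multiple : ∀ n → L (ℤ.+ n ⊙ u)
  multiple zero    = resp-≈ (λ _ → refl) 𝟎-closed
  multiple (suc n) = resp-≈ (λ i → sym (ℤ.suc-* (ℤ.+ n) (coeff u i))) (⊕-closed u∈ (multiple n))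
  go : ∀ z → L (z ⊙ u)
  go (ℤ.+ n)     = multiple n
  go ℤ.-[1+ n ] = resp-≈ (λ i → ℤ.neg-distribˡ-* ℤ.+[1+ n ] (coeff u i)) (⊖-closed (multiple (suc n)))

-- Division with remainder, one coordinate at a time: a `w` in L with minimal nonzero |w_k| clears
-- the coordinate `k` of every element of L, leaving a lattice supported in `K`. Excluded middle
-- decides whether L has an element nonzero at `k`, and whether one with a smaller entry exists.
finitely-generated : ExcludedMiddle 0ℓ → ∀ K {L : Pred (ℤ^I c d) 0ℓ} → IsLattice L →
                     (∀ {u} → L u → ∀ i → coeff u i ≢ 0ℤ → i ∈ K) →
                     ∃[ bs ] All L bs × L ⊆ ℤ⟨ (λ u → Any (u ≈_) bs) ⟩
finitely-generated em [] {L} isL L⊆K = [] , [] , λ {u} u∈ → resp (λ i → sym (vanishes u u∈ i)) zero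
  where
  vanishes : ∀ u → L u → ∀ i → coeff u i ≡ 0ℤ
  vanishes u u∈ i with coeff u i ℤ.≟ 0ℤ
  ... | yes ≡0 = ≡0
  ... | no  ≢0 with () ← L⊆K u∈ i ≢0
finitely-generated {c} {d} em (k ∷ K) {L} isL L⊆K with em {∃[ u ] L u × coeff u k ≢ 0ℤ}
... | no none = finitely-generated em K isL λ {u} u∈ i ≢0 → case L⊆K u∈ i ≢0 of λ where
        (here refl) → contradiction (u , u∈ , ≢0) none
        (there i∈)  → i∈
... | yes (u , u∈ , u≢0) with minimal ℤ.∣ coeff u k ∣ u∈ u≢0 ℕ.≤-refl
  where
  minimal : ∀ n {u} → L u → coeff u k ≢ 0ℤ → ℤ.∣ coeff u k ∣ ≤ n →
            ∃[ w ] L w × coeff w k ≢ 0ℤ × (∀ {v} → L v → coeff v k ≢ 0ℤ → ℤ.∣ coeff w k ∣ ≤ ℤ.∣ coeff v k ∣)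
  minimal zero    u∈ ≢0 ≤0 = contradiction (ℤ.∣i∣≡0⇒i≡0 (ℕ.n≤0⇒n≡0 ≤0)) ≢0
  minimal (suc n) {u} u∈ ≢0 ≤n with em {∃[ v ] L v × coeff v k ≢ 0ℤ × ℤ.∣ coeff v k ∣ < ℤ.∣ coeff u k ∣}
  ... | yes (v , v∈ , v≢0 , v<u) = minimal n v∈ v≢0 (ℕ.≤-pred (ℕ.≤-trans v<u ≤n))
  ... | no  none = u , u∈ , ≢0 , λ {v} v∈ v≢0 → ℕ.≮⇒≥ λ v<u → none (v , v∈ , v≢0 , v<u)
... | w , w∈ , w≢0 , w-least with finitely-generated em K L₀-isLattice L₀⊆K
  where
  open IsLattice isL
  L₀ : Pred (ℤ^I c d) 0ℓ
  L₀ u = L u × coeff u k ≡ 0ℤ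
  L₀-isLattice : IsLattice L₀
  L₀-isLattice = record
    { resp-≈   = λ u≈v (u∈ , u0) → resp-≈ u≈v u∈ , trans (sym (u≈v k)) u0
    ; 𝟎-closed = 𝟎-closed , refl
    ; ⊕-closed = λ (u∈ , u0) (v∈ , v0) → ⊕-closed u∈ v∈ , cong₂ ℤ._+_ u0 v0
    ; ⊖-closed = λ (u∈ , u0) → ⊖-closed u∈ , cong ℤ.-_ u0
    }
  L₀⊆K : ∀ {u} → L₀ u → ∀ i → coeff u i ≢ 0ℤ → i ∈ K
  L₀⊆K (u∈ , u0) i ≢0 with L⊆K u∈ i ≢0
  ... | here refl = contradiction u0 ≢0
  ... | there i∈  = i∈
... | bs , bs∈ , L₀⊆ = w ∷ bs , w∈ ∷ All.map proj₁ bs∈ , generates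
  where
  open IsLattice isL
  instance _ = ℤ.≢-nonZero w≢0
  generates : L ⊆ ℤ⟨ (λ u → Any (u ≈_) (w ∷ bs)) ⟩
  generates {u} u∈ = resp (λ i → cancel (coeff u i) (q ℤ.* coeff w i))
    (add (ℤ⟨⟩-mono there (L₀⊆ (v∈ , v0))) (⊙-closed ℤ⟨⟩-isLattice (gen {u = w} (here λ _ → refl)) q))
    where
    a = coeff u k
    q = a ℤ./ coeff w k
    v = u ⊕ (⊖ (q ⊙ w))
    cancel : ∀ x y → (x ℤ.- y) ℤ.+ y ≡ x
    cancel = solve-∀
    cancel′ : ∀ x y → (x ℤ.+ y) ℤ.- y ≡ x
    cancel′ = solve-∀
    v∈ : L v
    v∈ = ⊕-closed u∈ (⊖-closed (⊙-closed isL w∈ q))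
    v≡r : coeff v k ≡ ℤ.+ (a ℤ.% coeff w k)
    v≡r = trans (cong (ℤ._- q ℤ.* coeff w k) (a≡a%n+[a/n]*n a (coeff w k))) (cancel′ _ (q ℤ.* coeff w k))
    v0 : coeff v k ≡ 0ℤ
    v0 with coeff v k ℤ.≟ 0ℤ
    ... | yes ≡0 = ≡0
    -- The entry of `v` at `k` is the remainder of `a` modulo w_k; a nonzero one would contradict
    -- the minimality of `w`.
    ... | no  ≢0 = contradiction (w-least v∈ ≢0)
      (ℕ.<⇒≱ (subst (_< ℤ.∣ coeff w k ∣) (sym (cong ℤ.∣_∣ v≡r)) (n%d<d a (coeff w k))))

-- The four conditions

module _ {c d : ℕ} (𝔏 : SymInvariantChain c d) where
  open SymInvariantChain 𝔏

  ℤSym⊆L : ∀ {n B} → 1 ≤ n → B ⊆ L n → ℤ⟨ Sym⟨ n ⟩ [ B ] ⟩ ⊆ L n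
  ℤSym⊆L 1≤n B⊆L = ℤ⟨⟩-least (isLattice 1≤n) λ (σ , u , σ∈ , u∈ , v≈) →
    IsLattice.resp-≈ (isLattice 1≤n) (λ i → sym (v≈ i)) (invariant 1≤n {σ} σ∈ (B⊆L u∈))

  limit-invariant : ∀ σ {u} → Sym σ → limit 𝔏 u → limit 𝔏 (σ • u)
  limit-invariant σ (m , σ∈) (n , 1≤n , u∈) = m ⊔ n , 1≤ , invariant 1≤ {σ} (λ i ≤i → σ∈ i (ℕ.≤-trans (ℕ.m≤m⊔n m n) ≤i)) (monotone 1≤n (ℕ.m≤n⊔m m n) u∈)
    where
    1≤ : 1 ≤ m ⊔ n
    1≤ = ℕ.≤-trans 1≤n (ℕ.m≤n⊔m m n)

  limit-isLattice : IsLattice (limit 𝔏)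
  limit-isLattice = record
    { resp-≈   = λ u≈v (n , 1≤n , u∈) → n , 1≤n , IsLattice.resp-≈ (isLattice 1≤n) u≈v u∈
    ; 𝟎-closed = 1 , ℕ.≤-refl , IsLattice.𝟎-closed (isLattice ℕ.≤-refl)
    ; ⊕-closed = λ (m , 1≤m , u∈) (n , 1≤n , v∈) →
        let 1≤ = ℕ.≤-trans 1≤m (ℕ.m≤m⊔n m n) in
        m ⊔ n , 1≤ , IsLattice.⊕-closed (isLattice 1≤) (monotone 1≤m (ℕ.m≤m⊔n m n) u∈) (monotone 1≤n (ℕ.m≤n⊔m m n) v∈)
    ; ⊖-closed = λ (n , 1≤n , u∈) → n , 1≤n , IsLattice.⊖-closed (isLattice 1≤n) u∈
    }

  -- Finitely many vectors each lie in some member of the increasing chain; the maximum of the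
  -- levels serves.
  common-level : ∀ bs → (∀ {u} → Any (u ≈_) bs → limit 𝔏 u) →
                 ∃[ p ] 1 ≤ p × (∀ {u} → Any (u ≈_) bs → L p u)
  common-level []       _        = 1 , ℕ.≤-refl , λ ()
  common-level (b ∷ bs) ∈limit with ∈limit {b} (here λ _ → refl) | common-level bs (λ {u} u∈ → ∈limit {u} (there u∈))
  ... | m , 1≤m , b∈ | n , 1≤n , bs∈ = m ⊔ n , 1≤ , λ where
      (here u≈b) → monotone 1≤m (ℕ.m≤m⊔n m n) (IsLattice.resp-≈ (isLattice 1≤m) (λ i → sym (u≈b i)) b∈)
      (there u∈) → monotone 1≤n (ℕ.m≤n⊔m m n) (bs∈ u∈)
    where
    1≤ : 1 ≤ m ⊔ n
    1≤ = ℕ.≤-trans 1≤m (ℕ.m≤m⊔n m n)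

  stabilizes⇒stableGeneratingSet : Stabilizes 𝔏 → HasStableEquivariantGeneratingSet 𝔏
  -- All of `L p` is taken as the generating set.
  stabilizes⇒stableGeneratingSet (p , 1≤p , stable) = p , 1≤p , L p , generates p ℕ.≤-refl , generates
    where
    generates : ∀ n → p ≤ n → IsEquivariantGeneratingSet Sym⟨ n ⟩ (L n) (L p)
    generates n p≤n = monotone 1≤p p≤n , proj₂ (stable p n ℕ.≤-refl p≤n) , proj₁ (stable p n ℕ.≤-refl p≤n)

  stableGeneratingSet⇒stabilizes : HasStableEquivariantGeneratingSet 𝔏 → Stabilizes 𝔏
  stableGeneratingSet⇒stabilizes (p , 1≤p , B , (B⊆Lp , _) , generates) = p , 1≤p , λ m n p≤m m≤n →
    (λ u∈ → ℤ⟨⟩-mono (λ (σ , b , σ∈ , b∈ , eq) → σ , b , σ∈ , monotone 1≤p p≤m (B⊆Lp b∈) , eq)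
              (proj₂ (proj₂ (generates n (ℕ.≤-trans p≤m m≤n))) u∈)) ,
    ℤSym⊆L (ℕ.≤-trans 1≤p (ℕ.≤-trans p≤m m≤n)) (monotone (ℕ.≤-trans 1≤p p≤m) m≤n)

  -- For (a), an element of L_m in ℤ^(I_n) lies in the span of the Sym(m ⊔ n)-translates of B, and
  -- `saturated` cuts these down to Sym(n). For (b), translates of `B`, which lies in ℤ^(I_p), have
  -- at most |I_p| nonzero entries.
  stableGeneratingSet⇒saturated : HasStableEquivariantGeneratingSet 𝔏 → EventuallySaturatedWithBoundedSupport 𝔏
  stableGeneratingSet⇒saturated (p , 1≤p , B , (B⊆Lp , _) , generates) =
    -- The successor ensures that the support bound is at least 1.
    q , suc (length (indices {c} {d} p)) , ℕ.≤-trans 1≤p p≤q , s≤s z≤n , λ n q≤n →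
      let p≤n = ℕ.≤-trans p≤q q≤n
          1≤n = ℕ.≤-trans 1≤p p≤n in
      ( (λ u∈ → (n , 1≤n , u∈) , inside 1≤n u∈)
      , (λ ((m , 1≤m , u∈) , inI) → proj₁ (proj₂ (generates n p≤n))
           (saturated p≤n (ℕ.≤-trans (ℕ.m≤n⊔m p _) q≤n)
             (proj₂ (proj₂ (generates (m ⊔ n) (ℕ.≤-trans p≤n (ℕ.m≤n⊔m m n)))) (monotone 1≤m (ℕ.m≤m⊔n m n) u∈) , inI))) ) ,
      ( Sym⟨ n ⟩ [ B ]
      , (λ u∈ → proj₁ (proj₂ (generates n p≤n)) (gen u∈))
      , (λ {u} → small {n} {u})
      , proj₂ (generates n p≤n) )
    where
    B⊆ : B ⊆ ℤ^I⟨ p ⟩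
    B⊆ b∈ = inside 1≤p (B⊆Lp b∈)
    open Elimination B B⊆
    q = p ⊔ need (suc d)
    p≤q : p ≤ q
    p≤q = ℕ.m≤m⊔n p _
    small : ∀ {n u} → (Sym⟨ n ⟩ [ B ]) u → supportSize u ≤ suc (length (indices {c} {d} p))
    small {u = u} (σ , b , _ , b∈ , u≈) = ℕ.m≤n⇒m≤1+n (ℕ.≤-trans (supportSize-≤ u moved)
      (ℕ.≤-reflexive (List.length-map (σ •ᴵ_) (indices {c} {d} p))))
      where
      moved : ∀ i → coeff u i ≢ 0ℤ → i ∈ map (σ •ᴵ_) (indices p)
      moved i ≢0 = subst (_∈ map (σ •ᴵ_) (indices p)) (•ᴵ-cancelʳ σ i)
        (∈-map⁺ (σ •ᴵ_) (∈-indices (↔-sym σ •ᴵ i) (B⊆ b∈ _ λ ≡0 → ≢0 (trans (u≈ i) ≡0))))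

  saturated⇒finiteGeneratingSet : ExcludedMiddle 0ℓ →
    EventuallySaturatedWithBoundedSupport 𝔏 → LimitHasFiniteEquivariantGeneratingSet 𝔏
  saturated⇒finiteGeneratingSet em (q , q′ , 1≤q , _ , sat) =
    bs , (λ {u} → Bs⊆limit {u}) , ℤ⟨⟩-least limit-isLattice translates⊆limit , limit⊆
    where
    -- Saturation holds from `q` on, and a vector of support size at most q′ can be moved into
    -- ℤ^(I_m) once m is at least q′d.
    m = q ⊔ q′ * d
    1≤m : 1 ≤ m
    1≤m = ℕ.≤-trans 1≤q (ℕ.m≤m⊔n q _)
    basis : ∃[ bs ] All (L m) bs × L m ⊆ ℤ⟨ (λ u → Any (u ≈_) bs) ⟩
    basis = finitely-generated em (indices m) (isLattice 1≤m) (λ u∈ i ≢0 → ∈-indices i (inside 1≤m u∈ i ≢0))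
    bs  = proj₁ basis
    bs∈ = proj₁ (proj₂ basis)
    Lm⊆ : L m ⊆ ℤ⟨ (λ u → Any (u ≈_) bs) ⟩
    Lm⊆ = proj₂ (proj₂ basis)
    Bs : Pred (ℤ^I c d) 0ℓ
    Bs u = Any (u ≈_) bs
    Bs⊆limit : Bs ⊆ limit 𝔏
    Bs⊆limit {u} u∈ with All.lookupAny bs∈ u∈
    ... | b∈ , u≈b = m , 1≤m , IsLattice.resp-≈ (isLattice 1≤m) (λ i → sym (u≈b i)) b∈
    translates⊆limit : Sym [ Bs ] ⊆ limit 𝔏
    translates⊆limit (σ , u , σ∈ , u∈ , v≈) =
      IsLattice.resp-≈ limit-isLattice (λ i → sym (v≈ i)) (limit-invariant σ σ∈ (Bs⊆limit {u} u∈))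
    -- The inverse of σ turns each element of `Bs` into a Sym-translate and `σ • u` back into `u`.
    pull-back : ∀ σ → Sym σ → ∀ {u} → ℤ⟨ Bs ⟩ (σ • u) → ℤ⟨ Sym [ Bs ] ⟩ u
    pull-back σ (n , σ∈) {u} σu∈ = resp (λ i → cong (coeff u) (•ᴵ-cancelˡ σ i))
      (ℤ⟨⟩-least {L = ℤ⟨ Sym [ Bs ] ⟩ ∘ (↔-sym σ •_)} (•-preimage-isLattice (↔-sym σ) ℤ⟨⟩-isLattice)
        (λ {b} b∈ → gen (↔-sym σ , b , (n , σ⁻¹∈) , b∈ , λ _ → refl)) σu∈)
      where
      σ⁻¹∈ : Sym⟨ n ⟩ (↔-sym σ)
      σ⁻¹∈ i n≤i = trans (cong (Inverse.from σ) (sym (σ∈ i n≤i))) (Inverse.strictlyInverseʳ σ i)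
    from-small : ∀ {u} → limit 𝔏 u → supportSize u ≤ q′ → ℤ⟨ Sym [ Bs ] ⟩ u
    from-small {u} u∈ u≤q′ with compress u
    ... | σ , σ∈ , inI = pull-back σ σ∈ (Lm⊆ (proj₂ (proj₁ (sat m (ℕ.m≤m⊔n q _))) (limit-invariant σ σ∈ u∈ ,
           λ i ≢0 → rows-<⇒I i λ x∈ → ℕ.<-≤-trans (I⇒rows-< i (inI i ≢0) x∈)
             (ℕ.≤-trans (ℕ.*-monoˡ-≤ d u≤q′) (ℕ.m≤n⊔m q _)))))
    limit⊆ : limit 𝔏 ⊆ ℤ⟨ Sym [ Bs ] ⟩
    limit⊆ (n , 1≤n , u∈) with sat (n ⊔ q) (ℕ.m≤n⊔m n q)
    ... | _ , A , A⊆L , A≤ , _ , L⊆ℤA = ℤ⟨⟩-least ℤ⟨⟩-isLattice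
      (λ a∈ → from-small (n ⊔ q , ℕ.≤-trans 1≤n (ℕ.m≤m⊔n n q) , A⊆L a∈) (A≤ a∈))
      (L⊆ℤA (monotone 1≤n (ℕ.m≤m⊔n n q) u∈))

  -- The finite set itself serves: it lies in some L_p, an element of L_n with n ≥ q lies in the
  -- span of its Sym-translates, and `saturated` replaces Sym by Sym(n).
  finiteGeneratingSet⇒stableGeneratingSet :
    LimitHasFiniteEquivariantGeneratingSet 𝔏 → HasStableEquivariantGeneratingSet 𝔏
  finiteGeneratingSet⇒stableGeneratingSet (bs , Bs⊆limit , _ , limit⊆) with common-level bs (λ {u} → Bs⊆limit {u})
  ... | p , 1≤p , Bs⊆Lp = q , 1≤q , Bs , generates q ℕ.≤-refl , generates
    where
    Bs : Pred (ℤ^I c d) 0ℓ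
    Bs u = Any (u ≈_) bs
    Bs⊆ : Bs ⊆ ℤ^I⟨ p ⟩
    Bs⊆ {u} u∈ = inside 1≤p (Bs⊆Lp {u} u∈)
    open Elimination Bs (λ {u} → Bs⊆ {u})
    q = p ⊔ need (suc d)
    1≤q : 1 ≤ q
    1≤q = ℕ.≤-trans 1≤p (ℕ.m≤m⊔n p _)
    generates : ∀ n → q ≤ n → IsEquivariantGeneratingSet Sym⟨ n ⟩ (L n) Bs
    generates n q≤n = (λ {u} → Bs⊆Ln {u}) , ℤSym⊆L 1≤n (λ {u} → Bs⊆Ln {u}) ,
      λ u∈ → saturated p≤n (ℕ.≤-trans (ℕ.m≤n⊔m p _) q≤n) (limit⊆ (n , 1≤n , u∈) , inside 1≤n u∈)
      where
      1≤n = ℕ.≤-trans 1≤q q≤n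
      p≤n = ℕ.≤-trans (ℕ.m≤m⊔n p _) q≤n
      Bs⊆Ln : Bs ⊆ L n
      Bs⊆Ln {u} u∈ = monotone 1≤p p≤n (Bs⊆Lp {u} u∈)

theorem3p6 : ExcludedMiddle 0ℓ →
    (c d : ℕ) → 1 ≤ c → 1 ≤ d → (𝔏 : SymInvariantChain c d) →
    (Stabilizes 𝔏 ⇔ HasStableEquivariantGeneratingSet 𝔏)
    × (HasStableEquivariantGeneratingSet 𝔏 ⇔ EventuallySaturatedWithBoundedSupport 𝔏)
    × (EventuallySaturatedWithBoundedSupport 𝔏 ⇔ LimitHasFiniteEquivariantGeneratingSet 𝔏)
theorem3p6 em c d _ _ 𝔏 =
  -- After the direct equivalence of (i) and (ii), the cycle (ii) ⇒ (iii) ⇒ (iv) ⇒ (ii) yields the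
  -- other two.
  mk⇔ (stabilizes⇒stableGeneratingSet 𝔏) (stableGeneratingSet⇒stabilizes 𝔏) ,
  mk⇔ (stableGeneratingSet⇒saturated 𝔏)
      (finiteGeneratingSet⇒stableGeneratingSet 𝔏 ∘ saturated⇒finiteGeneratingSet 𝔏 em) ,
  mk⇔ (saturated⇒finiteGeneratingSet 𝔏 em)
      (stableGeneratingSet⇒saturated 𝔏 ∘ finiteGeneratingSet⇒stableGeneratingSet 𝔏)
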